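{- Let $n\ge 6$ and $n-1<m<2(n-2)$. Then the difference graph with vertex-eigenvector $(1,1;\,m-n+2,\,2n-4-m)$ is the unique (up to isomorphism) bipartite optimal graph in $\mathfrak{B}_{n,m}$.
   Context: All graphs are finite, simple and undirected. For a graph $G$ on $n$ vertices with adjacency matrix $\mathbf{A}(G)$, write $\det(\lambda I-\mathbf{A}(G))=\sum_{i=0}^n \mathbf{a}_i(G)\lambda^{n-i}$, so $\mathbf{a}_4(G)$ is the coefficient of $\lambda^{n-4}$. $\mathfrak{B}_{n,m}$ is the set of connected bipartite graphs with $n$ vertices and $m$ edges; $G\in\mathfrak{B}_{n,m}$ is bipartite optimal if $\mathbf{a}_4(G)=\min\{\mathbf{a}_4(H):H\in\mathfrak{B}_{n,m}\}$. A difference graph with vertex-eigenvector $(x_1,\ldots,x_k;y_1,\ldots,y_k)$ (positive integers) is the graph whose vertex set is the disjoint union of sets $X_1,\ldots,X_k,Y_1,\ldots,Y_k$ with $|X_i|=x_i$, $|Y_i|=y_i$, in which $x\in X_i$ and $y\in Y_j$ are adjacent if and only if $i+j\le k+1$, with no other edges. Thus the graph in the claim has one vertex adjacent to all $n-2$ vertices of $Y_1\cup Y_2$ and one vertex adjacent to the $m-n+2$ vertices of $Y_1$. -}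

module Defs where

open import Data.Bool using (Bool; true; false; if_then_else_; _∧_; _∨_)
open import Data.Nat as ℕ using (ℕ; zero; suc; _∸_; _<ᵇ_; _≤ᵇ_)
open import Data.Integer as ℤ using (ℤ; +_; -_)
open import Data.Fin using (Fin; zero; suc; toℕ; punchIn)
open import Data.Fin.Properties using () renaming (_≟_ to _≟ᶠ_)
open import Data.List using (List; []; _∷_; map; foldr; allFin; _++_)
open import Data.Nat.ListAction using (sum)
open import Data.Vec using (Vec; toList)
open import Data.Product using (Σ; _×_; _,_)
open import Function.Bundles using (_↔_; Inverse)
open import Relation.Nullary.Decidable using (⌊_⌋)
open import Relation.Binary.PropositionalEquality using (_≡_; _≢_)

Graph : ℕ → Set
Graph N = Fin N → Fin N → Bool

IsSimple : ∀ {N} → Graph N → Set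
IsSimple {N} G = (∀ u v → G u v ≡ G v u) × (∀ u → G u u ≡ false)

finSum : ∀ {A : Set} → (A → A → A) → A → (N : ℕ) → (Fin N → A) → A
finSum _⊕_ e N f = foldr (λ i acc → f i ⊕ acc) e (allFin N)

edgeCount : ∀ {N} → Graph N → ℕ
edgeCount {N} G =
  finSum ℕ._+_ 0 N (λ u → finSum ℕ._+_ 0 N (λ v →
    if G u v ∧ (toℕ u <ᵇ toℕ v) then 1 else 0))

data Reach {N} (G : Graph N) : Fin N → Fin N → Set where
  here : ∀ {u} → Reach G u u
  step : ∀ {u w v} → G u w ≡ true → Reach G w v → Reach G u v

Connected : ∀ {N} → Graph N → Set
Connected {N} G = ∀ (u v : Fin N) → Reach G u v

Bipartite : ∀ {N} → Graph N → Set
Bipartite {N} G = Σ (Fin N → Bool) λ c → ∀ u v → G u v ≡ true → c u ≢ c v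

Iso : ∀ {N N'} → Graph N → Graph N' → Set
Iso {N} {N'} G H =
  Σ (Fin N ↔ Fin N') λ f → ∀ u v → G u v ≡ H (Inverse.to f u) (Inverse.to f v)

-- Polynomials over ℤ as coefficient lists, lowest degree first.

Poly : Set
Poly = List ℤ

padd : Poly → Poly → Poly
padd [] q = q
padd (a ∷ p) [] = a ∷ p
padd (a ∷ p) (b ∷ q) = (a ℤ.+ b) ∷ padd p q

pscale : ℤ → Poly → Poly
pscale c = map (c ℤ.*_)

pmul : Poly → Poly → Poly
pmul [] q = []
pmul (a ∷ p) q = padd (pscale a q) (+ 0 ∷ pmul p q)

coeff : ℕ → Poly → ℤ
coeff k [] = + 0
coeff zero (a ∷ p) = a
coeff (suc k) (a ∷ p) = coeff k p

sign : ℕ → ℤ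
sign zero = + 1
sign (suc k) = - sign k

det : (N : ℕ) → (Fin N → Fin N → Poly) → Poly
det zero M = + 1 ∷ []
det (suc N) M =
  finSum padd [] (suc N) (λ j →
    pscale (sign (toℕ j)) (pmul (M zero j) (det N (λ i k → M (suc i) (punchIn j k)))))

charPoly : ∀ {N} → Graph N → Poly
charPoly {N} G = det N (λ i j →
  padd (if ⌊ i ≟ᶠ j ⌋ then (+ 0 ∷ + 1 ∷ []) else [])
       (if G i j then (- (+ 1) ∷ []) else []))

acoef : ℕ → ∀ {N} → Graph N → ℤ
acoef i {N} G = coeff (N ∸ i) (charPoly G)

InB : (n m : ℕ) → ∀ {N} → Graph N → Set
InB n m {N} G = N ≡ n × IsSimple G × Connected G × Bipartite G × edgeCount G ≡ m

BipartiteOptimal : (n m : ℕ) → ∀ {N} → Graph N → Set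
BipartiteOptimal n m G =
  InB n m G × (∀ {N'} (H : Graph N') → InB n m H → acoef 4 G ℤ.≤ acoef 4 H)

-- Difference graph with vertex-eigenvector (x_1..x_k ; y_1..y_k).
-- Vertices 0..N-1 are listed block by block: X_1,...,X_k,Y_1,...,Y_k.

blockOf : List ℕ → ℕ → ℕ
blockOf [] v = 0
blockOf (s ∷ ss) v = if v <ᵇ s then 0 else suc (blockOf ss (v ∸ s))

-- block a is X_{a+1} (a < k), block b is Y_{b-k+1} (b ≥ k);
-- condition i + j ≤ k+1 becomes a + b < 2k
xyAdj : ℕ → ℕ → ℕ → Bool
xyAdj k a b = (a <ᵇ k) ∧ (k ≤ᵇ b) ∧ ((a ℕ.+ b) <ᵇ (k ℕ.+ k))

diffGraph : (k : ℕ) (x y : Vec ℕ k) →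
  Graph (sum (toList x) ℕ.+ sum (toList y))
diffGraph k x y u v =
  xyAdj k (blockOf sizes (toℕ u)) (blockOf sizes (toℕ v)) ∨
  xyAdj k (blockOf sizes (toℕ v)) (blockOf sizes (toℕ u))
  where sizes = toList x ++ toList y

{-# OPTIONS --safe #-}

-- For a bipartite graph with parts X and Y, the coefficient a₄ is the sum of the squares of the 2 × 2 minors
-- of the biadjacency matrix.  Both sides satisfy (n - 4) a(G) = Σ_v a(G - v): for the characteristic
-- polynomial this is its derivative, for the sum of minors it is a count; and they agree for n = 4.
--
-- Let p = |X|, q = |Y|, t = m - n + 2 and s = 2n - 4 - m.  If X = {a, b}, then
-- a₄ = t s + (q - deg a)(q - deg b), so the minimum t s is attained exactly when a or b is adjacent to all of Y,
-- which determines the graph.  If p, q ≥ 3, then a₄ > t s.  Indeed, deleting a leaf of X with neighbour w lowers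
-- a₄ by m - deg w and t s by t ≤ m - deg w - (q - 2), which is handled by induction; and if there is no leaf,
-- counting the nonedges between X and Y gives a₄ ≥ 2 (p q - m) = t s + ((m - 2p)(m - 2q) + s²) / 2.

module Submission where

open import Defs
open import Data.Bool using (Bool; true; false; if_then_else_; not; _∧_; _∨_; _xor_; T)
import Data.Bool.Properties as Bool
open import Data.Fin using (Fin; zero; suc; toℕ; punchIn; punchOut)
import Data.Fin.Permutation as Perm
import Data.Fin.Properties as Fin
open import Data.Integer as ℤ using (ℤ; +_; -_; _+_; _*_; _-_; _≤_; +≤+)
import Data.Integer.Properties as ℤ
open import Data.Integer.Tactic.RingSolver using (solve-∀)
open import Data.List using (foldr; tabulate; allFin) renaming ([] to []ˡ; _∷_ to _∷ˡ_)
open import Data.Nat as ℕ using (ℕ; zero; suc; z≤n; s≤s; _<ᵇ_)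
import Data.Nat.Properties as ℕ
import Data.Nat.Tactic.RingSolver as ℕSolver
open import Data.Product using (_×_; _,_; proj₁; proj₂; ∃; Σ)
open import Data.Sum as Sum using (_⊎_; inj₁; inj₂)
open import Data.Vec using ([]; _∷_; lookup)
open import Function using (_∘_)
open import Function.Bundles using (_↔_; Inverse)
open import Relation.Nullary using (yes; no; does; contradiction; ¬_)
open import Relation.Nullary.Decidable using (⌊_⌋; dec-true; dec-false)
open import Relation.Binary.PropositionalEquality
open ≡-Reasoning
import Algebra.Properties.Semiring.Sum ℤ.+-*-semiring as ΣSum

-- Differentiating det (xI - A) row by row turns row v into a unit row, so the recursion for the
-- coefficients needs neither permutations nor cycle covers. Its factor n - 4 can be cancelled only
-- from n = 5 on, hence the separate case n = 4. The minors are summed over ordered pairs of rows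
-- and of columns, so the sum is 4 a₄ and the inequalities for it below carry a factor 4. The
-- obstacle in the induction is that deleting a leaf may leave a class of two vertices, where
-- equality is possible, so the induction hypothesis can only be the weak bound. Strictness has to
-- come from the step itself: from the surplus q - 2 ≥ 1 of a leaf deletion, with q the size of the
-- class opposite to the leaf, or from s² when there is no leaf.

opaque
  -- Opaque, so that conversion checking never expands a sum; beyond the basic laws of this block,
  -- only the exhaustive check on four vertices unfolds it.
  ∑ : ∀ {N} → (Fin N → ℤ) → ℤ
  ∑ = ΣSum.sum

  ∑-empty : (f : Fin 0 → ℤ) → ∑ f ≡ + 0
  ∑-empty f = refl

  ∑-suc : ∀ {N} (f : Fin (suc N) → ℤ) → ∑ f ≡ f zero + ∑ (f ∘ suc)
  ∑-suc f = refl

  ∑-cong : ∀ {N} {f g : Fin N → ℤ} → (∀ i → f i ≡ g i) → ∑ f ≡ ∑ g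
  ∑-cong = ΣSum.sum-cong-≗

  ∑-remove : ∀ {N} i (f : Fin (suc N) → ℤ) → ∑ f ≡ f i + ∑ (λ j → f (punchIn i j))
  ∑-remove i f = ΣSum.sum-remove {i = i} f

  ∑-+ : ∀ {N} (f g : Fin N → ℤ) → ∑ (λ i → f i + g i) ≡ ∑ f + ∑ g
  ∑-+ = ΣSum.∑-distrib-+

  ∑-swap : ∀ {M N} (f : Fin M → Fin N → ℤ) → ∑ (λ i → ∑ (f i)) ≡ ∑ (λ j → ∑ (λ i → f i j))
  ∑-swap = ΣSum.∑-comm

  ∑-* : ∀ {N} c (f : Fin N → ℤ) → ∑ (λ i → c * f i) ≡ c * ∑ f
  ∑-* c f = sym (ΣSum.*-distribˡ-sum c f)

  ∑-0 : ∀ {N} {f : Fin N → ℤ} → (∀ i → f i ≡ + 0) → ∑ f ≡ + 0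
  ∑-0 {N} f≡0 = trans (ΣSum.sum-cong-≗ f≡0) (ΣSum.sum-replicate-zero N)

-- The derivative of a determinant

-- The tail of `allFin (suc N)` is `tabulate suc` and not an `allFin`; this reindexing makes
-- `finSum` peel off its first summand.
foldr-tabulate : ∀ {A B C : Set} (_⊕_ : A → B → B) (e : B) (f : C → A) {N} (g : Fin N → C) →
  foldr (λ c acc → f c ⊕ acc) e (tabulate g) ≡ foldr (λ i acc → f (g i) ⊕ acc) e (allFin N)
foldr-tabulate _⊕_ e f {zero} g = refl
foldr-tabulate _⊕_ e f {suc N} g = cong (f (g zero) ⊕_)
  (trans (foldr-tabulate _⊕_ e f (g ∘ suc)) (sym (foldr-tabulate _⊕_ e (f ∘ g) suc)))

finSum-suc : ∀ {A : Set} (_⊕_ : A → A → A) (e : A) N (f : Fin (suc N) → A) →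
  finSum _⊕_ e (suc N) f ≡ f zero ⊕ finSum _⊕_ e N (f ∘ suc)
finSum-suc _⊕_ e N f = cong (f zero ⊕_) (foldr-tabulate _⊕_ e f suc)

-- The entry (a , b) stands for the polynomial a + b x, and a polynomial for its sequence of coefficients.

Mat : ℕ → ℕ → Set
Mat R C = Fin R → Fin C → ℤ × ℤ

-- Multiplication by x; `act` below is multiplication by a + b x.
shift : (ℕ → ℤ) → ℕ → ℤ
shift g zero = + 0
shift g (suc k) = g k

act : ℤ × ℤ → (ℕ → ℤ) → ℕ → ℤ
act (a , b) g k = a * g k + b * shift g k

minor : ∀ {R C} → Fin (suc R) → Fin (suc C) → Mat (suc R) (suc C) → Mat R C
minor i j M a b = M (punchIn i a) (punchIn j b)

-- The same expansion along the first row as `det`. Coefficient sequences are compared pointwise,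
-- whereas lists of coefficients for one polynomial may differ in trailing zeros.
detCoeff : (N : ℕ) → Mat N N → ℕ → ℤ
detCoeff zero M zero = + 1
detCoeff zero M (suc k) = + 0
detCoeff (suc N) M k =
  ∑ λ j → sign (toℕ j) * act (M zero j) (detCoeff N (minor zero j M)) k

shift-cong : ∀ {g h} → g ≗ h → shift g ≗ shift h
shift-cong g≗h zero = refl
shift-cong g≗h (suc k) = g≗h k

act-cong : ∀ e {g h} → g ≗ h → act e g ≗ act e h
act-cong (a , b) g≗h k = cong₂ (λ x y → a * x + b * y) (g≗h k) (shift-cong g≗h k)

act-zero : ∀ {g} e → (∀ k → g k ≡ + 0) → ∀ k → act e g k ≡ + 0
act-zero {g} (a , b) g≡0 k = trans (cong₂ (λ x y → a * x + b * y) (g≡0 k) (shift-0 k)) (lem a b)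
  where
  shift-0 : ∀ k → shift g k ≡ + 0
  shift-0 zero = refl
  shift-0 (suc k) = g≡0 k
  lem : ∀ a b → a * + 0 + b * + 0 ≡ + 0
  lem = solve-∀

act-scale : ∀ e c g k → act e (λ k → c * g k) k ≡ c * act e g k
act-scale (a , b) c g zero = lem a b c (g zero)
  where
  lem : ∀ a b c x → a * (c * x) + b * + 0 ≡ c * (a * x + b * + 0)
  lem = solve-∀
act-scale (a , b) c g (suc k) = lem a b c (g (suc k)) (g k)
  where
  lem : ∀ a b c x y → a * (c * x) + b * (c * y) ≡ c * (a * x + b * y)
  lem = solve-∀

detCoeff-cong : ∀ N {M M′ : Mat N N} → (∀ i j → M i j ≡ M′ i j) → detCoeff N M ≗ detCoeff N M′
detCoeff-cong zero M≗M′ zero = refl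
detCoeff-cong zero M≗M′ (suc k) = refl
detCoeff-cong (suc N) {M} {M′} M≗M′ k = ∑-cong λ j → cong (sign (toℕ j) *_) (begin
  act (M zero j) (detCoeff N (minor zero j M)) k
    ≡⟨ act-cong (M zero j) (detCoeff-cong N (λ a b → M≗M′ (suc a) (punchIn j b))) k ⟩
  act (M zero j) (detCoeff N (minor zero j M′)) k
    ≡⟨ cong (λ e → act e (detCoeff N (minor zero j M′)) k) (M≗M′ zero j) ⟩
  act (M′ zero j) (detCoeff N (minor zero j M′)) k ∎)

coeff-padd : ∀ k p q → coeff k (padd p q) ≡ coeff k p + coeff k q
coeff-padd k []ˡ q = sym (ℤ.+-identityˡ _)
coeff-padd k (a ∷ˡ p) []ˡ = sym (ℤ.+-identityʳ _)
coeff-padd zero (a ∷ˡ p) (b ∷ˡ q) = refl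
coeff-padd (suc k) (a ∷ˡ p) (b ∷ˡ q) = coeff-padd k p q

coeff-pscale : ∀ k c p → coeff k (pscale c p) ≡ c * coeff k p
coeff-pscale k c []ˡ = sym (ℤ.*-zeroʳ c)
coeff-pscale zero c (a ∷ˡ p) = refl
coeff-pscale (suc k) c (a ∷ˡ p) = coeff-pscale k c p

coeff-finSum : ∀ k N (f : Fin N → Poly) → coeff k (finSum padd []ˡ N f) ≡ ∑ (λ j → coeff k (f j))
coeff-finSum k zero f = sym (∑-empty _)
coeff-finSum k (suc N) f = begin
  coeff k (finSum padd []ˡ (suc N) f)                ≡⟨ cong (coeff k) (finSum-suc padd []ˡ N f) ⟩
  coeff k (padd (f zero) (finSum padd []ˡ N (f ∘ suc))) ≡⟨ coeff-padd k (f zero) _ ⟩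
  coeff k (f zero) + coeff k (finSum padd []ˡ N (f ∘ suc)) ≡⟨ cong (_+_ (coeff k (f zero))) (coeff-finSum k N (f ∘ suc)) ⟩
  coeff k (f zero) + ∑ (λ j → coeff k (f (suc j))) ≡⟨ sym (∑-suc (λ j → coeff k (f j))) ⟩
  ∑ (λ j → coeff k (f j)) ∎

-- Stated through products because `det` uses an entry only as the left factor of `pmul`.
Represents : Poly → ℤ × ℤ → Set
Represents p e = ∀ q k → coeff k (pmul p q) ≡ act e (λ k → coeff k q) k

coeff-det : ∀ N (P : Fin N → Fin N → Poly) (M : Mat N N) → (∀ i j → Represents (P i j) (M i j)) →
  ∀ k → coeff k (det N P) ≡ detCoeff N M k
coeff-det zero P M rep zero = refl
coeff-det zero P M rep (suc k) = refl
coeff-det (suc N) P M rep k = begin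
  coeff k (finSum padd []ˡ (suc N) expansion)  ≡⟨ coeff-finSum k (suc N) expansion ⟩
  ∑ (λ j → coeff k (expansion j))             ≡⟨ ∑-cong summand ⟩
  detCoeff (suc N) M k                        ∎
  where
  Pminor : Fin (suc N) → Fin N → Fin N → Poly
  Pminor j a b = P (suc a) (punchIn j b)
  expansion : Fin (suc N) → Poly
  expansion j = pscale (sign (toℕ j)) (pmul (P zero j) (det N (Pminor j)))
  summand : ∀ j → coeff k (expansion j) ≡ sign (toℕ j) * act (M zero j) (detCoeff N (minor zero j M)) k
  summand j = begin
    coeff k (expansion j)
      ≡⟨ coeff-pscale k (sign (toℕ j)) (pmul (P zero j) (det N (Pminor j))) ⟩
    sign (toℕ j) * coeff k (pmul (P zero j) (det N (Pminor j)))
      ≡⟨ cong (sign (toℕ j) *_) (rep zero j (det N (Pminor j)) k) ⟩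
    sign (toℕ j) * act (M zero j) (λ k → coeff k (det N (Pminor j))) k
      ≡⟨ cong (sign (toℕ j) *_) (act-cong (M zero j)
           (coeff-det N (Pminor j) (minor zero j M) (λ a b → rep (suc a) (punchIn j b))) k) ⟩
    sign (toℕ j) * act (M zero j) (detCoeff N (minor zero j M)) k ∎

detCoeff-zeroRow : ∀ {N} (M : Mat N N) i → (∀ j → M i j ≡ (+ 0 , + 0)) → ∀ k → detCoeff N M k ≡ + 0
detCoeff-zeroRow M zero row k = ∑-0 λ j →
  trans (cong (λ e → sign (toℕ j) * act e (detCoeff _ (minor zero j M)) k) (row j)) (ℤ.*-zeroʳ (sign (toℕ j)))
detCoeff-zeroRow {suc (suc N)} M (suc i) row k = ∑-0 λ j →
  trans (cong (sign (toℕ j) *_) (act-zero (M zero j) (detCoeff-zeroRow (minor zero j M) i (λ b → row (punchIn j b))) k))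
        (ℤ.*-zeroʳ (sign (toℕ j)))

-- The position of k once the column punchIn k l is deleted.
punchInPos : ∀ {N} → Fin (suc (suc N)) → Fin (suc N) → Fin (suc N)
punchInPos zero l = zero
punchInPos (suc k) zero = k
punchInPos {suc N} (suc k) (suc l) = suc (punchInPos k l)

punchIn-punchInPos : ∀ {N} (k : Fin (suc (suc N))) l → punchIn (punchIn k l) (punchInPos k l) ≡ k
punchIn-punchInPos zero l = refl
punchIn-punchInPos (suc k) zero = refl
punchIn-punchInPos {suc N} (suc k) (suc l) = cong suc (punchIn-punchInPos k l)

punchIn-comm : ∀ {N} (k : Fin (suc (suc N))) l (x : Fin N) →
  punchIn (punchIn k l) (punchIn (punchInPos k l) x) ≡ punchIn k (punchIn l x)
punchIn-comm zero l x = refl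
punchIn-comm (suc k) zero x = refl
punchIn-comm {suc N} (suc k) (suc l) zero = refl
punchIn-comm {suc N} (suc k) (suc l) (suc x) = cong suc (punchIn-comm k l x)

-- Of two columns, only the left one shifts the position of the other when it is deleted. The two
-- orders of deletion therefore give sums of positions that differ by one.
sign-punchIn : ∀ {N} (k : Fin (suc (suc N))) l →
  sign (toℕ (punchIn k l)) * sign (toℕ (punchInPos k l)) ≡ - (sign (toℕ k) * sign (toℕ l))
sign-punchIn zero l = lem (sign (toℕ l))
  where
  lem : ∀ x → - x * + 1 ≡ - (+ 1 * x)
  lem = solve-∀
sign-punchIn (suc k) zero = lem (sign (toℕ k))
  where
  lem : ∀ x → + 1 * x ≡ - (- x * + 1)
  lem = solve-∀
sign-punchIn {suc N} (suc k) (suc l) =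
  trans (neg-neg (sign (toℕ (punchIn k l))) (sign (toℕ (punchInPos k l))))
      (trans (sign-punchIn k l) (cong -_ (sym (neg-neg (sign (toℕ k)) (sign (toℕ l))))))
  where
  neg-neg : ∀ x y → - x * - y ≡ x * y
  neg-neg = solve-∀

-- Laplace expansion along an arbitrary row, in the only case that is needed. Expanding along the
-- first row, the term of column `k` removes the single 1 and leaves a zero row; every other column
-- is some `punchIn k l` and leaves a unit row, to which induction on `i` applies.
detCoeff-unitRow : ∀ {N} (M : Mat (suc N) (suc N)) i k →
  M i k ≡ (+ 1 , + 0) → (∀ l → M i (punchIn k l) ≡ (+ 0 , + 0)) →
  ∀ m → detCoeff (suc N) M m ≡ sign (toℕ i) * sign (toℕ k) * detCoeff N (minor i k M) m
detCoeff-unitRow {N} M zero k eq row m = begin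
  ∑ (λ j → sign (toℕ j) * act (M zero j) (detCoeff N (minor zero j M)) m)
    ≡⟨ ∑-remove k (λ j → sign (toℕ j) * act (M zero j) (detCoeff _ (minor zero j M)) m) ⟩
  sign (toℕ k) * act (M zero k) (detCoeff N (minor zero k M)) m
    + ∑ (λ l → sign (toℕ (punchIn k l)) * act (M zero (punchIn k l)) (detCoeff N (minor zero (punchIn k l) M)) m)
    ≡⟨ cong₂ _+_ (cong (λ e → sign (toℕ k) * act e (detCoeff N (minor zero k M)) m) eq)
       (∑-0 λ l → trans (cong (λ e → sign (toℕ (punchIn k l)) * act e (detCoeff N (minor zero (punchIn k l) M)) m)
           (row l)) (ℤ.*-zeroʳ (sign (toℕ (punchIn k l))))) ⟩
  sign (toℕ k) * (+ 1 * detCoeff N (minor zero k M) m + + 0 * shift (detCoeff N (minor zero k M)) m) + + 0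
    ≡⟨ lem (sign (toℕ k)) (detCoeff N (minor zero k M) m) (shift (detCoeff N (minor zero k M)) m) ⟩
  + 1 * sign (toℕ k) * detCoeff N (minor zero k M) m ∎
  where
  lem : ∀ a x y → a * (+ 1 * x + + 0 * y) + + 0 ≡ + 1 * a * x
  lem = solve-∀
detCoeff-unitRow {suc N} M (suc i) k eq row m = begin
  ∑ (λ j → sign (toℕ j) * act (M zero j) (detCoeff (suc N) (minor zero j M)) m)
    ≡⟨ ∑-remove k (λ j → sign (toℕ j) * act (M zero j) (detCoeff _ (minor zero j M)) m) ⟩
  sign (toℕ k) * act (M zero k) (detCoeff (suc N) (minor zero k M)) m + ∑ (λ l → term l)
    ≡⟨ cong₂ _+_ (trans (cong (sign (toℕ k) *_) (act-zero (M zero k) (detCoeff-zeroRow (minor zero k M) i row) m))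
                        (ℤ.*-zeroʳ (sign (toℕ k))))
                 (∑-cong summand) ⟩
  + 0 + ∑ (λ l → c * term′ l)
    ≡⟨ trans (ℤ.+-identityˡ _) (∑-* c term′) ⟩
  c * detCoeff (suc N) (minor (suc i) k M) m ∎
  where
  c = sign (toℕ (suc i)) * sign (toℕ k)
  term term′ : Fin (suc N) → ℤ
  term l = sign (toℕ (punchIn k l)) * act (M zero (punchIn k l)) (detCoeff (suc N) (minor zero (punchIn k l) M)) m
  term′ l = sign (toℕ l) * act (M zero (punchIn k l)) (detCoeff N (minor zero l (minor (suc i) k M))) m
  summand : ∀ l → term l ≡ c * term′ l
  summand l = begin
    sj * act e (detCoeff (suc N) (minor zero j M)) m
      ≡⟨ cong (sj *_) (act-cong e IH m) ⟩
    sj * act e (λ m → si * sk′ * detCoeff N (minor zero l (minor (suc i) k M)) m) m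
      ≡⟨ cong (sj *_) (act-scale e (si * sk′) (detCoeff N (minor zero l (minor (suc i) k M))) m) ⟩
    sj * (si * sk′ * x)  ≡⟨ lem₁ sj si sk′ x ⟩
    sj * sk′ * (si * x)  ≡⟨ cong (_* (si * x)) (sign-punchIn k l) ⟩
    - (sign (toℕ k) * sign (toℕ l)) * (si * x) ≡⟨ lem₂ (sign (toℕ k)) (sign (toℕ l)) si x ⟩
    c * term′ l ∎
    where
    j = punchIn k l
    k′ = punchInPos k l
    sj = sign (toℕ j)
    si = sign (toℕ i)
    sk′ = sign (toℕ k′)
    e = M zero j
    x = act e (detCoeff N (minor zero l (minor (suc i) k M))) m
    lem₁ : ∀ a b c x → a * (b * c * x) ≡ a * c * (b * x)
    lem₁ = solve-∀
    lem₂ : ∀ a b c x → - (a * b) * (c * x) ≡ - c * a * (b * x)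
    lem₂ = solve-∀
    row′ : ∀ x → M (suc i) (punchIn j (punchIn k′ x)) ≡ (+ 0 , + 0)
    row′ x = trans (cong (M (suc i)) (punchIn-comm k l x)) (row (punchIn l x))
    IH : ∀ m → detCoeff (suc N) (minor zero j M) m ≡ si * sk′ * detCoeff N (minor zero l (minor (suc i) k M)) m
    IH m = trans
      (detCoeff-unitRow (minor zero j M) i k′ (trans (cong (M (suc i)) (punchIn-punchInPos k l)) eq) row′ m)
      (cong (si * sk′ *_) (detCoeff-cong N (λ a b → cong (M (suc (punchIn i a))) (punchIn-comm k l b)) m))

-- The entrywise derivative of row `i`: a + b x becomes the constant b.
derivRow : ∀ {R C} → Fin R → Mat R C → Mat R C
derivRow i M a b = if does (i Fin.≟ a) then (proj₂ (M a b) , + 0) else M a b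

-- The Leibniz rule for a determinant, read off at x^k. In the expansion along the first row the
-- product rule gives `u`, with the entry differentiated, and `v`, with a row of the minor
-- differentiated.
detCoeff-deriv : ∀ N (M : Mat N N) k →
  + suc k * detCoeff N M (suc k) ≡ ∑ (λ i → detCoeff N (derivRow i M) k)

-- The same rule multiplied by x, for the part b x of an entry in front of a differentiated minor.
shift-deriv : ∀ N (M : Mat N N) k →
  + k * detCoeff N M k ≡ ∑ (λ i → shift (detCoeff N (derivRow i M)) k)
shift-deriv N M zero = sym (∑-0 λ i → refl)
shift-deriv N M (suc k) = detCoeff-deriv N M k

detCoeff-deriv zero M k = trans (ℤ.*-zeroʳ (+ suc k)) (sym (∑-empty _))
detCoeff-deriv (suc N) M k = begin
  + suc k * ∑ t                                 ≡⟨ sym (∑-* (+ suc k) t) ⟩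
  ∑ (λ j → + suc k * t j)                       ≡⟨ ∑-cong summand ⟩
  ∑ (λ j → u j + ∑ (λ i → v i j))             ≡⟨ ∑-+ u (λ j → ∑ (λ i → v i j)) ⟩
  ∑ u + ∑ (λ j → ∑ (λ i → v i j))           ≡⟨ cong (_+_ (∑ u)) (∑-swap (λ j i → v i j)) ⟩
  ∑ u + ∑ (λ i → ∑ (λ j → v i j))
    ≡⟨ sym (∑-suc (λ i → detCoeff (suc N) (derivRow i M) k)) ⟩
  ∑ (λ i → detCoeff (suc N) (derivRow i M) k)     ∎
  where
  t u : Fin (suc N) → ℤ
  t j = sign (toℕ j) * act (M zero j) (detCoeff N (minor zero j M)) (suc k)
  u j = sign (toℕ j) * act (proj₂ (M zero j) , + 0) (detCoeff N (minor zero j M)) k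
  v : Fin N → Fin (suc N) → ℤ
  v i j = sign (toℕ j) * act (M zero j) (detCoeff N (derivRow i (minor zero j M))) k
  summand : ∀ j → + suc k * t j ≡ u j + ∑ (λ i → v i j)
  summand j = begin
    + suc k * (s * (a * g (suc k) + b * g k))  ≡⟨ cong (_* (s * (a * g (suc k) + b * g k))) (ℤ.pos-+ 1 k) ⟩
    -- The summand b g k splits by 1 + k: one copy is the derivative of the entry, the other k
    -- copies belong to the derivative of the minor.
    (+ 1 + + k) * (s * (a * g (suc k) + b * g k))  ≡⟨ lem₁ (+ k) s a b (g (suc k)) (g k) (shift g k) ⟩
    u j + (s * a * ((+ 1 + + k) * g (suc k)) + s * b * (+ k * g k))
      ≡⟨ cong (λ x → u j + (s * a * (x * g (suc k)) + s * b * (+ k * g k))) (sym (ℤ.pos-+ 1 k)) ⟩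
    u j + (s * a * (+ suc k * g (suc k)) + s * b * (+ k * g k))
      ≡⟨ cong₂ (λ x y → u j + (s * a * x + s * b * y))
           (detCoeff-deriv N (minor zero j M) k) (shift-deriv N (minor zero j M) k) ⟩
    u j + (s * a * ∑ (λ i → h i k) + s * b * ∑ (λ i → shift (h i) k))
      ≡⟨ cong (_+_ (u j)) (cong₂ _+_ (sym (∑-* (s * a) (λ i → h i k))) (sym (∑-* (s * b) (λ i → shift (h i) k)))) ⟩
    u j + (∑ (λ i → s * a * h i k) + ∑ (λ i → s * b * shift (h i) k))
      ≡⟨ cong (_+_ (u j)) (sym (∑-+ (λ i → s * a * h i k) (λ i → s * b * shift (h i) k))) ⟩
    u j + ∑ (λ i → s * a * h i k + s * b * shift (h i) k)
      ≡⟨ cong (_+_ (u j)) (∑-cong λ i → lem₂ s a b (h i k) (shift (h i) k)) ⟩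
    u j + ∑ (λ i → v i j) ∎
    where
    s = sign (toℕ j)
    a = proj₁ (M zero j)
    b = proj₂ (M zero j)
    g = detCoeff N (minor zero j M)
    h : Fin N → ℕ → ℤ
    h i = detCoeff N (derivRow i (minor zero j M))
    lem₁ : ∀ k s a b x y z →
      (+ 1 + k) * (s * (a * x + b * y)) ≡ s * (b * y + + 0 * z) + (s * a * ((+ 1 + k) * x) + s * b * (k * y))
    lem₁ = solve-∀
    lem₂ : ∀ s a b x y → s * a * x + s * b * y ≡ s * (a * x + b * y)
    lem₂ = solve-∀

-- xI - A(G)
charMat : ∀ {N} → Graph N → Mat N N
charMat G i j = (if G i j then - (+ 1) else + 0) , (if does (i Fin.≟ j) then + 1 else + 0)

coeff-charPoly : ∀ {N} (G : Graph N) k → coeff k (charPoly G) ≡ detCoeff N (charMat G) k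
coeff-charPoly {N} G = coeff-det N _ (charMat G) rep
  where
  coeff-0∷ : ∀ p k → coeff k (+ 0 ∷ˡ p) ≡ shift (λ k → coeff k p) k
  coeff-0∷ p zero = refl
  coeff-0∷ p (suc k) = refl
  coeff-0∷[] : ∀ k → coeff k (+ 0 ∷ˡ []ˡ) ≡ + 0
  coeff-0∷[] zero = refl
  coeff-0∷[] (suc k) = refl
  const : ∀ a q k → coeff k (pmul (a ∷ˡ []ˡ) q) ≡ act (a , + 0) (λ k → coeff k q) k
  const a q k = begin
    coeff k (padd (pscale a q) (+ 0 ∷ˡ []ˡ))  ≡⟨ coeff-padd k (pscale a q) _ ⟩
    coeff k (pscale a q) + coeff k (+ 0 ∷ˡ []ˡ)  ≡⟨ cong₂ _+_ (coeff-pscale k a q) (coeff-0∷[] k) ⟩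
    a * coeff k q + + 0 ∎
  linear : ∀ a b → Represents (a ∷ˡ b ∷ˡ []ˡ) (a , b)
  linear a b q k = begin
    coeff k (padd (pscale a q) (+ 0 ∷ˡ pmul (b ∷ˡ []ˡ) q))  ≡⟨ coeff-padd k (pscale a q) _ ⟩
    coeff k (pscale a q) + coeff k (+ 0 ∷ˡ pmul (b ∷ˡ []ˡ) q)  ≡⟨ cong₂ _+_ (coeff-pscale k a q)
        (coeff-0∷ (pmul (b ∷ˡ []ˡ) q) k) ⟩
    a * coeff k q + shift (λ k → coeff k (pmul (b ∷ˡ []ˡ) q)) k
      ≡⟨ cong (_+_ (a * coeff k q)) (trans (shift-cong (λ k → trans (const b q k) (ℤ.+-identityʳ _)) k) (shift-scale k)) ⟩
    a * coeff k q + b * shift (λ k → coeff k q) k ∎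
    where
    shift-scale : ∀ k → shift (λ k → b * coeff k q) k ≡ b * shift (λ k → coeff k q) k
    shift-scale zero = sym (ℤ.*-zeroʳ b)
    shift-scale (suc k) = refl
  rep : ∀ i j → Represents (padd (if ⌊ i Fin.≟ j ⌋ then (+ 0 ∷ˡ + 1 ∷ˡ []ˡ) else []ˡ)
                                 (if G i j then (- (+ 1) ∷ˡ []ˡ) else []ˡ)) (charMat G i j)
  rep i j q k with i Fin.≟ j | G i j
  rep i j q k | yes _ | true = linear (- (+ 1)) (+ 1) q k
  rep i j q k | yes _ | false = linear (+ 0) (+ 1) q k
  rep i j q k | no _ | true = const (- (+ 1)) q k
  rep i j q k | no _ | false = refl

_-ᵛ_ : ∀ {N} → Graph (suc N) → Fin (suc N) → Graph N
(G -ᵛ v) i j = G (punchIn v i) (punchIn v j)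

-- Row v of xI - A(G) differentiates to the unit row at v. Expanding there leaves the characteristic
-- matrix of the graph without v, with sign (-1)^(v+v) = 1.
coeff-charPoly-deriv : ∀ {N} (G : Graph (suc N)) k →
  + suc k * coeff (suc k) (charPoly G) ≡ ∑ (λ v → coeff k (charPoly (G -ᵛ v)))
coeff-charPoly-deriv {N} G k = begin
  + suc k * coeff (suc k) (charPoly G)  ≡⟨ cong (+ suc k *_) (coeff-charPoly G (suc k)) ⟩
  + suc k * detCoeff (suc N) M (suc k)  ≡⟨ detCoeff-deriv (suc N) M k ⟩
  ∑ (λ v → detCoeff (suc N) (derivRow v M) k)  ≡⟨ ∑-cong summand ⟩
  ∑ (λ v → coeff k (charPoly (G -ᵛ v))) ∎
  where
  M = charMat G
  off-diagonal : ∀ v (l : Fin N) → does (v Fin.≟ punchIn v l) ≡ false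
  off-diagonal v l = dec-false (v Fin.≟ punchIn v l) (Fin.punchInᵢ≢i v l ∘ sym)
  diag : ∀ v b → derivRow v M v b ≡ ((if does (v Fin.≟ b) then + 1 else + 0) , + 0)
  diag v b rewrite dec-true (v Fin.≟ v) refl = refl
  rest : ∀ v a b → minor v v (derivRow v M) a b ≡ charMat (G -ᵛ v) a b
  rest v a b rewrite off-diagonal v a with a Fin.≟ b
  ... | yes refl rewrite dec-true (punchIn v a Fin.≟ punchIn v a) refl = refl
  ... | no a≢b rewrite dec-false (punchIn v a Fin.≟ punchIn v b) (a≢b ∘ Fin.punchIn-injective v a b) = refl
  sign-square : ∀ n → sign n * sign n ≡ + 1
  sign-square zero = refl
  sign-square (suc n) = trans (neg-neg (sign n)) (sign-square n)
    where
    neg-neg : ∀ x → - x * - x ≡ x * x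
    neg-neg = solve-∀
  summand : ∀ v → detCoeff (suc N) (derivRow v M) k ≡ coeff k (charPoly (G -ᵛ v))
  summand v = begin
    detCoeff (suc N) (derivRow v M) k
      ≡⟨ detCoeff-unitRow (derivRow v M) v v
           (trans (diag v v) (cong (λ b → (if b then + 1 else + 0) , + 0) (dec-true (v Fin.≟ v) refl)))
           (λ l → trans (diag v (punchIn v l)) (cong (λ b → (if b then + 1 else + 0) , + 0) (off-diagonal v l))) k ⟩
    sign (toℕ v) * sign (toℕ v) * detCoeff N (minor v v (derivRow v M)) k
      ≡⟨ cong₂ _*_ (sign-square (toℕ v)) (detCoeff-cong N (rest v) k) ⟩
    + 1 * detCoeff N (charMat (G -ᵛ v)) k  ≡⟨ ℤ.*-identityˡ _ ⟩
    detCoeff N (charMat (G -ᵛ v)) k        ≡⟨ sym (coeff-charPoly (G -ᵛ v) k) ⟩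
    coeff k (charPoly (G -ᵛ v)) ∎

-- The sum of squared minors

⟦_⟧ : Bool → ℤ
⟦ true ⟧ = + 1
⟦ false ⟧ = + 0

∑₄ : ∀ {N} → (Fin N → Fin N → Fin N → Fin N → ℤ) → ℤ
∑₄ f = ∑ λ a → ∑ λ b → ∑ λ x → ∑ λ y → f a b x y

∑₄-cong : ∀ {N} {f g : Fin N → Fin N → Fin N → Fin N → ℤ} → (∀ a b x y → f a b x y ≡ g a b x y) → ∑₄ f ≡ ∑₄ g
∑₄-cong f≡g = ∑-cong λ a → ∑-cong λ b → ∑-cong λ x → ∑-cong λ y → f≡g a b x y

∑₄-* : ∀ {N} c (f : Fin N → Fin N → Fin N → Fin N → ℤ) → ∑₄ (λ a b x y → c * f a b x y) ≡ c * ∑₄ f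
∑₄-* c f = trans (∑-cong λ a → trans (∑-cong λ b → trans (∑-cong λ x → ∑-* c (f a b x))
  (∑-* c (λ x → ∑ (f a b x)))) (∑-* c (λ b → ∑ λ x → ∑ (f a b x)))) (∑-* c (λ a → ∑ λ b → ∑ λ x → ∑ (f a b x)))

∑-∑₄ : ∀ {M N} (f : Fin M → Fin N → Fin N → Fin N → Fin N → ℤ) →
  ∑ (λ v → ∑₄ (f v)) ≡ ∑₄ (λ a b x y → ∑ λ v → f v a b x y)
∑-∑₄ f = trans (∑-swap (λ v a → ∑ λ b → ∑ λ x → ∑ (f v a b x)))
  (∑-cong λ a → trans (∑-swap (λ v b → ∑ λ x → ∑ (f v a b x)))
  (∑-cong λ b → trans (∑-swap (λ v x → ∑ (f v a b x)))
  (∑-cong λ x → ∑-swap (λ v y → f v a b x y))))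

opaque
  δ : ∀ {N} → Fin N → Fin N → ℤ
  δ u v = ⟦ does (u Fin.≟ v) ⟧

  δ-refl : ∀ {N} (u : Fin N) → δ u u ≡ + 1
  δ-refl u rewrite dec-true (u Fin.≟ u) refl = refl

  δ-≢ : ∀ {N} {u v : Fin N} → u ≢ v → δ u v ≡ + 0
  δ-≢ {_} {u} {v} u≢v rewrite dec-false (u Fin.≟ v) u≢v = refl

∑-δ : ∀ {N} (u : Fin N) → ∑ (λ v → δ v u) ≡ + 1
∑-δ {suc N} u = trans (∑-remove u (λ v → δ v u))
  (cong₂ _+_ (δ-refl u) (∑-0 λ l → δ-≢ (Fin.punchInᵢ≢i u l)))

-- The weight 1 - δ replaces an index set depending on `v` by a fixed one, so that the sum over `v`
-- can later be exchanged with the others.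
∑-punchIn : ∀ {N} v (h : Fin (suc N) → ℤ) → ∑ (λ i → h (punchIn v i)) ≡ ∑ (λ i → (+ 1 - δ v i) * h i)
∑-punchIn v h = sym (begin
  ∑ (λ i → (+ 1 - δ v i) * h i)
    ≡⟨ ∑-remove v (λ i → (+ 1 - δ v i) * h i) ⟩
  (+ 1 - δ v v) * h v + ∑ (λ i → (+ 1 - δ v (punchIn v i)) * h (punchIn v i))
    ≡⟨ cong₂ _+_ (cong (λ x → (+ 1 - x) * h v) (δ-refl v))
         (∑-cong λ i → cong (λ x → (+ 1 - x) * h (punchIn v i)) (δ-≢ (Fin.punchInᵢ≢i v i ∘ sym))) ⟩
  + 0 + ∑ (λ i → + 1 * h (punchIn v i))
    ≡⟨ trans (ℤ.+-identityˡ _) (∑-cong λ i → ℤ.*-identityˡ (h (punchIn v i))) ⟩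
  ∑ (λ i → h (punchIn v i)) ∎)

∑₄-punchIn : ∀ {N} v (f : Fin (suc N) → Fin (suc N) → Fin (suc N) → Fin (suc N) → ℤ) →
  ∑₄ (λ a b x y → f (punchIn v a) (punchIn v b) (punchIn v x) (punchIn v y)) ≡
  ∑₄ (λ a b x y → (+ 1 - δ v a) * ((+ 1 - δ v b) * ((+ 1 - δ v x) * ((+ 1 - δ v y) * f a b x y))))
∑₄-punchIn {N} v f = trans
  (∑-cong λ a → trans (∑-cong λ b → trans (∑-cong λ x → ∑-punchIn v (f (p a) (p b) (p x)))
    (level (λ x y → w y * f (p a) (p b) x y)))
    (level₂ (λ b x y → w x * (w y * f (p a) b x y))))
    (level₃ (λ a b x y → w b * (w x * (w y * f a b x y))))
  where
  p = punchIn v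
  w : Fin (suc N) → ℤ
  w i = + 1 - δ v i
  level : (h : Fin (suc N) → Fin (suc N) → ℤ) →
    ∑ (λ x → ∑ (h (p x))) ≡ ∑ (λ x → ∑ λ y → w x * h x y)
  level h = trans (∑-punchIn v (λ x → ∑ (h x))) (∑-cong λ x → sym (∑-* (w x) (h x)))
  level₂ : (h : Fin (suc N) → Fin (suc N) → Fin (suc N) → ℤ) →
    ∑ (λ b → ∑ λ x → ∑ (h (p b) x)) ≡ ∑ (λ b → ∑ λ x → ∑ λ y → w b * h b x y)
  level₂ h = trans (level (λ b x → ∑ (h b x))) (∑-cong λ b → ∑-cong λ x → sym (∑-* (w b) (h b x)))
  level₃ : (h : Fin (suc N) → Fin (suc N) → Fin (suc N) → Fin (suc N) → ℤ) →
    ∑ (λ a → ∑ λ b → ∑ λ x → ∑ (h (p a) b x)) ≡ ∑ (λ a → ∑ λ b → ∑ λ x → ∑ λ y → w a * h a b x y)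
  level₃ h = trans (level₂ (λ a b x → ∑ (h a b x)))
    (∑-cong λ a → ∑-cong λ b → ∑-cong λ x → sym (∑-* (w a) (h a b x)))

∑-1 : ∀ N → ∑ {N} (λ _ → + 1) ≡ + N
∑-1 zero = ∑-empty _
∑-1 (suc N) = trans (∑-suc {N} (λ _ → + 1)) (trans (cong (_+_ (+ 1)) (∑-1 N)) (sym (ℤ.pos-+ 1 N)))

∑-const : ∀ N c → ∑ {N} (λ _ → c) ≡ + N * c
∑-const N c = begin
  ∑ {N} (λ _ → c)        ≡⟨ ∑-cong (λ _ → sym (ℤ.*-identityʳ c)) ⟩
  ∑ {N} (λ _ → c * + 1)  ≡⟨ ∑-* c (λ _ → + 1) ⟩
  c * ∑ {N} (λ _ → + 1)  ≡⟨ cong (c *_) (∑-1 N) ⟩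
  c * + N                ≡⟨ ℤ.*-comm c (+ N) ⟩
  + N * c ∎

Distinct : ∀ {N} → (a b x y : Fin N) → Set
Distinct a b x y = (a ≢ b × a ≢ x × a ≢ y) × (b ≢ x × b ≢ y) × x ≢ y

-- Double counting: four distinct vertices survive the deletion of exactly the n - 4 vertices
-- outside them.
∑₄-delete : ∀ {N} (f : Fin (suc N) → Fin (suc N) → Fin (suc N) → Fin (suc N) → ℤ) →
  (∀ a b x y → f a b x y ≡ + 0 ⊎ Distinct a b x y) →
  ∑ (λ v → ∑₄ (λ a b x y → f (punchIn v a) (punchIn v b) (punchIn v x) (punchIn v y)))
  ≡ (+ suc N - + 4) * ∑₄ f
∑₄-delete {N} f dist = begin
  ∑ (λ v → ∑₄ (λ a b x y → f (punchIn v a) (punchIn v b) (punchIn v x) (punchIn v y)))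
    ≡⟨ ∑-cong (λ v → ∑₄-punchIn v f) ⟩
  ∑ (λ v → ∑₄ (g v))                        ≡⟨ ∑-∑₄ g ⟩
  ∑₄ (λ a b x y → ∑ λ v → g v a b x y)      ≡⟨ ∑₄-cong count ⟩
  ∑₄ (λ a b x y → (+ suc N - + 4) * f a b x y) ≡⟨ ∑₄-* (+ suc N - + 4) f ⟩
  (+ suc N - + 4) * ∑₄ f ∎
  where
  g : Fin (suc N) → Fin (suc N) → Fin (suc N) → Fin (suc N) → Fin (suc N) → ℤ
  g v a b x y = (+ 1 - δ v a) * ((+ 1 - δ v b) * ((+ 1 - δ v x) * ((+ 1 - δ v y) * f a b x y)))
  zeros : ∀ a b x y → a * (b * (x * (y * + 0))) ≡ + 0
  zeros = solve-∀
  count : ∀ a b x y → ∑ (λ v → g v a b x y) ≡ (+ suc N - + 4) * f a b x y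
  count a b x y with dist a b x y
  ... | inj₁ f≡0 = trans
    (∑-0 λ v → trans (cong (λ z → (+ 1 - δ v a) * ((+ 1 - δ v b) * ((+ 1 - δ v x) * ((+ 1 - δ v y) * z)))) f≡0)
      (zeros (+ 1 - δ v a) (+ 1 - δ v b) (+ 1 - δ v x) (+ 1 - δ v y)))
    (sym (trans (cong ((+ suc N - + 4) *_) f≡0) (ℤ.*-zeroʳ (+ suc N - + 4))))
  ... | inj₂ ((a≢b , a≢x , a≢y) , (b≢x , b≢y) , x≢y) = begin
    ∑ (λ v → g v a b x y)                      ≡⟨ ∑-cong expand ⟩
    ∑ (λ v → z * (+ 1) + - z * (δ v a + (δ v b + (δ v x + δ v y))))
      ≡⟨ ∑-+ (λ v → z * (+ 1)) (λ v → - z * (δ v a + (δ v b + (δ v x + δ v y)))) ⟩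
    ∑ {suc N} (λ v → z * (+ 1)) + ∑ (λ v → - z * (δ v a + (δ v b + (δ v x + δ v y))))
      ≡⟨ cong₂ _+_ (∑-const (suc N) (z * + 1)) (∑-* (- z) (λ v → δ v a + (δ v b + (δ v x + δ v y)))) ⟩
    + suc N * (z * + 1) + - z * ∑ (λ v → δ v a + (δ v b + (δ v x + δ v y)))
      ≡⟨ cong (λ k → + suc N * (z * + 1) + - z * k) four ⟩
    + suc N * (z * + 1) + - z * + 4            ≡⟨ lem (+ suc N) z ⟩
    (+ suc N - + 4) * z ∎
    where
    z = f a b x y
    lem : ∀ n z → n * (z * + 1) + - z * + 4 ≡ (n - + 4) * z
    lem = solve-∀
    four : ∑ (λ v → δ v a + (δ v b + (δ v x + δ v y))) ≡ + 4
    four = trans (∑-+ (λ v → δ v a) (λ v → δ v b + (δ v x + δ v y))) (cong₂ _+_ (∑-δ a)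
      (trans (∑-+ (λ v → δ v b) (λ v → δ v x + δ v y)) (cong₂ _+_ (∑-δ b)
      (trans (∑-+ (λ v → δ v x) (λ v → δ v y)) (cong₂ _+_ (∑-δ x) (∑-δ y))))))
    weight : ℤ → ℤ → ℤ → ℤ → ℤ
    weight p q r s = (+ 1 - p) * ((+ 1 - q) * ((+ 1 - r) * ((+ 1 - s) * z)))
    at : ∀ v {p q r s} → δ v a ≡ p → δ v b ≡ q → δ v x ≡ r → δ v y ≡ s →
      weight p q r s ≡ z * + 1 + - z * (p + (q + (r + s))) →
      g v a b x y ≡ z * (+ 1) + - z * (δ v a + (δ v b + (δ v x + δ v y)))
    at v refl refl refl refl eq = eq
    only₁ : ∀ z → (+ 1 - + 1) * ((+ 1 - + 0) * ((+ 1 - + 0) * ((+ 1 - + 0) * z))) ≡ z * + 1 + - z *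
        (+ 1 + (+ 0 + (+ 0 + + 0)))
    only₁ = solve-∀
    only₂ : ∀ z → (+ 1 - + 0) * ((+ 1 - + 1) * ((+ 1 - + 0) * ((+ 1 - + 0) * z))) ≡ z * + 1 + - z *
        (+ 0 + (+ 1 + (+ 0 + + 0)))
    only₂ = solve-∀
    only₃ : ∀ z → (+ 1 - + 0) * ((+ 1 - + 0) * ((+ 1 - + 1) * ((+ 1 - + 0) * z))) ≡ z * + 1 + - z *
        (+ 0 + (+ 0 + (+ 1 + + 0)))
    only₃ = solve-∀
    only₄ : ∀ z → (+ 1 - + 0) * ((+ 1 - + 0) * ((+ 1 - + 0) * ((+ 1 - + 1) * z))) ≡ z * + 1 + - z *
        (+ 0 + (+ 0 + (+ 0 + + 1)))
    only₄ = solve-∀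
    none : ∀ z → (+ 1 - + 0) * ((+ 1 - + 0) * ((+ 1 - + 0) * ((+ 1 - + 0) * z))) ≡ z * + 1 + - z *
        (+ 0 + (+ 0 + (+ 0 + + 0)))
    none = solve-∀
    -- A vertex `v` equals at most one of the four distinct ones, so the product of the weights 1 -
    -- δ agrees with 1 minus the sum of the δ.
    expand : ∀ v → g v a b x y ≡ z * (+ 1) + - z * (δ v a + (δ v b + (δ v x + δ v y)))
    expand v with v Fin.≟ a
    ... | yes refl = at v (δ-refl a) (δ-≢ a≢b) (δ-≢ a≢x) (δ-≢ a≢y) (only₁ z)
    ... | no v≢a with v Fin.≟ b
    ... | yes refl = at v (δ-≢ v≢a) (δ-refl b) (δ-≢ b≢x) (δ-≢ b≢y) (only₂ z)
    ... | no v≢b with v Fin.≟ x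
    ... | yes refl = at v (δ-≢ v≢a) (δ-≢ v≢b) (δ-refl x) (δ-≢ x≢y) (only₃ z)
    ... | no v≢x with v Fin.≟ y
    ... | yes refl = at v (δ-≢ v≢a) (δ-≢ v≢b) (δ-≢ v≢x) (δ-refl y) (only₄ z)
    ... | no v≢y = at v (δ-≢ v≢a) (δ-≢ v≢b) (δ-≢ v≢x) (δ-≢ v≢y) (none z)

quad : ∀ {N} → Graph N → (Fin N → Bool) → Fin N → Fin N → Fin N → Fin N → ℤ
quad G c a b x y = ⟦ c a ⟧ * ⟦ c b ⟧ * (⟦ not (c x) ⟧ * ⟦ not (c y) ⟧) *
  ((⟦ G a x ⟧ * ⟦ G b y ⟧ - ⟦ G a y ⟧ * ⟦ G b x ⟧) * (⟦ G a x ⟧ * ⟦ G b y ⟧ - ⟦ G a y ⟧ * ⟦ G b x ⟧))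

-- Rows are the vertices coloured true; each minor is counted four times, once per ordering of its rows and columns.
minorSum : ∀ {N} → Graph N → (Fin N → Bool) → ℤ
minorSum G c = ∑₄ (quad G c)

-- A minor with a repeated row or column vanishes, and a row index never equals a column index
-- because their colours differ.
quad-distinct : ∀ {N} (G : Graph N) c a b x y → quad G c a b x y ≡ + 0 ⊎ Distinct a b x y
quad-distinct G c a b x y with c a in ca | c b in cb | c x in cx | c y in cy
... | false | _ | _ | _ = inj₁ refl
... | true | false | _ | _ = inj₁ refl
... | true | true | true | _ = inj₁ refl
... | true | true | false | true = inj₁ refl
... | true | true | false | false with a Fin.≟ b | x Fin.≟ y
... | yes refl | _ = inj₁ (lem ⟦ G a x ⟧ ⟦ G a y ⟧)
  where
  lem : ∀ p q → + 1 * ((p * q - q * p) * (p * q - q * p)) ≡ + 0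
  lem = solve-∀
... | no _ | yes refl = inj₁ (lem ⟦ G a x ⟧ ⟦ G b x ⟧)
  where
  lem : ∀ p q → + 1 * ((p * q - p * q) * (p * q - p * q)) ≡ + 0
  lem = solve-∀
... | no a≢b | no x≢y = inj₂ ((a≢b , differ ca cx , differ ca cy) , (differ cb cx , differ cb cy) , x≢y)
  where
  differ : ∀ {u v} → c u ≡ true → c v ≡ false → u ≢ v
  differ cu cv refl with trans (sym cu) cv
  ... | ()

minorSum-delete : ∀ {N} (G : Graph (suc N)) c →
  ∑ (λ v → minorSum (G -ᵛ v) (c ∘ punchIn v)) ≡ (+ suc N - + 4) * minorSum G c
minorSum-delete G c = ∑₄-delete (quad G c) (quad-distinct G c)

-- The identity on four vertices, by exhaustion

opaque
  allBool : (Bool → Bool) → Bool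
  allBool f = f true ∧ f false

  allBool-sound : ∀ f → allBool f ≡ true → ∀ b → f b ≡ true
  allBool-sound f ok true with f true
  ... | true = refl
  allBool-sound f ok false with f true | f false
  ... | true | true = refl

  -- An edge is tried as present only between different colours, which restricts the exhaustive
  -- check to properly coloured graphs.
  allCrossing : Bool → Bool → (Bool → Bool) → Bool
  allCrossing c c′ f = if c xor c′ then allBool f else f false

  allCrossing-sound : ∀ c c′ f → allCrossing c c′ f ≡ true → ∀ b → (b ≡ true → c ≢ c′) → f b ≡ true
  allCrossing-sound true true f ok true cross = contradiction refl (cross refl)
  allCrossing-sound true true f ok false cross = ok
  allCrossing-sound true false f ok b cross = allBool-sound f ok b
  allCrossing-sound false true f ok b cross = allBool-sound f ok b
  allCrossing-sound false false f ok true cross = contradiction refl (cross refl)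
  allCrossing-sound false false f ok false cross = ok

graph₄ : (e₀₁ e₀₂ e₀₃ e₁₂ e₁₃ e₂₃ : Bool) → Graph 4
graph₄ e₀₁ e₀₂ e₀₃ e₁₂ e₁₃ e₂₃ u v = lookup (lookup
  ( (false ∷ e₀₁ ∷ e₀₂ ∷ e₀₃ ∷ [])
  ∷ (e₀₁ ∷ false ∷ e₁₂ ∷ e₁₃ ∷ [])
  ∷ (e₀₂ ∷ e₁₂ ∷ false ∷ e₂₃ ∷ [])
  ∷ (e₀₃ ∷ e₁₃ ∷ e₂₃ ∷ false ∷ []) ∷ []) u) v

coloring₄ : (c₀ c₁ c₂ c₃ : Bool) → Fin 4 → Bool
coloring₄ c₀ c₁ c₂ c₃ = lookup (c₀ ∷ c₁ ∷ c₂ ∷ c₃ ∷ [])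

opaque
  agree₄ : (c₀ c₁ c₂ c₃ e₀₁ e₀₂ e₀₃ e₁₂ e₁₃ e₂₃ : Bool) → Bool
  agree₄ c₀ c₁ c₂ c₃ e₀₁ e₀₂ e₀₃ e₁₂ e₁₃ e₂₃ =
    does (+ 4 * coeff 0 (charPoly (graph₄ e₀₁ e₀₂ e₀₃ e₁₂ e₁₃ e₂₃))
      ℤ.≟ minorSum (graph₄ e₀₁ e₀₂ e₀₃ e₁₂ e₁₃ e₂₃) (coloring₄ c₀ c₁ c₂ c₃))

  agree₄-sound : ∀ {c₀ c₁ c₂ c₃ e₀₁ e₀₂ e₀₃ e₁₂ e₁₃ e₂₃} →
    agree₄ c₀ c₁ c₂ c₃ e₀₁ e₀₂ e₀₃ e₁₂ e₁₃ e₂₃ ≡ true →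
    + 4 * coeff 0 (charPoly (graph₄ e₀₁ e₀₂ e₀₃ e₁₂ e₁₃ e₂₃)) ≡
    minorSum (graph₄ e₀₁ e₀₂ e₀₃ e₁₂ e₁₃ e₂₃) (coloring₄ c₀ c₁ c₂ c₃)
  agree₄-sound {c₀} {c₁} {c₂} {c₃} {e₀₁} {e₀₂} {e₀₃} {e₁₂} {e₁₃} {e₂₃} eq
    with + 4 * coeff 0 (charPoly (graph₄ e₀₁ e₀₂ e₀₃ e₁₂ e₁₃ e₂₃))
      ℤ.≟ minorSum (graph₄ e₀₁ e₀₂ e₀₃ e₁₂ e₁₃ e₂₃) (coloring₄ c₀ c₁ c₂ c₃)
  ... | yes equal = equal

allAgree₄ : Bool
allAgree₄ =
  allBool λ c₀ → allBool λ c₁ → allBool λ c₂ → allBool λ c₃ →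
  allCrossing c₀ c₁ λ e₀₁ → allCrossing c₀ c₂ λ e₀₂ → allCrossing c₀ c₃ λ e₀₃ →
  allCrossing c₁ c₂ λ e₁₂ → allCrossing c₁ c₃ λ e₁₃ → allCrossing c₂ c₃ λ e₂₃ →
  agree₄ c₀ c₁ c₂ c₃ e₀₁ e₀₂ e₀₃ e₁₂ e₁₃ e₂₃

opaque
  -- Evaluation runs through 162 coloured graphs: 1 + 32 + 96 + 32 + 1, by the number of vertices
  -- coloured `true`.
  unfolding ∑ allBool allCrossing agree₄

  allAgree₄-holds : allAgree₄ ≡ true
  allAgree₄-holds = refl

-- The identity on any number of vertices

Coloring : ℕ → Set
Coloring N = Fin N → Bool

Proper : ∀ {N} → Graph N → Coloring N → Set
Proper G c = ∀ u v → G u v ≡ true → c u ≢ c v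

simple-delete : ∀ {N} {G : Graph (suc N)} v → IsSimple G → IsSimple (G -ᵛ v)
simple-delete v (sym , irr) = (λ a b → sym (punchIn v a) (punchIn v b)) , (λ a → irr (punchIn v a))

proper-delete : ∀ {N} {G : Graph (suc N)} {c} v → Proper G c → Proper (G -ᵛ v) (c ∘ punchIn v)
proper-delete v proper a b = proper (punchIn v a) (punchIn v b)

coeff-charPoly-cong : ∀ {N} {G H : Graph N} → (∀ u v → G u v ≡ H u v) → ∀ k → coeff k (charPoly G) ≡ coeff k (charPoly H)
coeff-charPoly-cong {N} {G} {H} G≗H k = trans (coeff-charPoly G k) (trans
  (detCoeff-cong N (λ u v → cong (λ b → (if b then - (+ 1) else + 0) , (if does (u Fin.≟ v) then + 1 else + 0))
      (G≗H u v)) k)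
  (sym (coeff-charPoly H k)))

minorSum-cong : ∀ {N} {G H : Graph N} {c d} → (∀ u v → G u v ≡ H u v) → (∀ u → c u ≡ d u) → minorSum G c ≡ minorSum H d
minorSum-cong {N} {G} {H} {c} {d} G≗H c≗d = ∑₄-cong eq
  where
  eq : ∀ a b x y → quad G c a b x y ≡ quad H d a b x y
  eq a b x y rewrite c≗d a | c≗d b | c≗d x | c≗d y | G≗H a x | G≗H b y | G≗H a y | G≗H b x = refl

minorSum≡4a₄-base : (G : Graph 4) (c : Coloring 4) → IsSimple G → Proper G c →
  + 4 * coeff 0 (charPoly G) ≡ minorSum G c
minorSum≡4a₄-base G c (symm , irr) proper = begin
  + 4 * coeff 0 (charPoly G)  ≡⟨ cong (+ 4 *_) (coeff-charPoly-cong G≗ 0) ⟩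
  + 4 * coeff 0 (charPoly G′) ≡⟨ agree₄-sound agree ⟩
  minorSum G′ c′              ≡⟨ sym (minorSum-cong G≗ c≗) ⟩
  minorSum G c ∎
  where
  0₄ 1₄ 2₄ 3₄ : Fin 4
  0₄ = zero
  1₄ = suc zero
  2₄ = suc (suc zero)
  3₄ = suc (suc (suc zero))
  G′ = graph₄ (G 0₄ 1₄) (G 0₄ 2₄) (G 0₄ 3₄) (G 1₄ 2₄) (G 1₄ 3₄) (G 2₄ 3₄)
  c′ = coloring₄ (c 0₄) (c 1₄) (c 2₄) (c 3₄)
  c≗ : ∀ u → c u ≡ c′ u
  c≗ zero = refl
  c≗ (suc zero) = refl
  c≗ (suc (suc zero)) = refl
  c≗ (suc (suc (suc zero))) = refl
  G≗ : ∀ u v → G u v ≡ G′ u v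
  G≗ zero zero = irr zero
  G≗ zero (suc zero) = refl
  G≗ zero (suc (suc zero)) = refl
  G≗ zero (suc (suc (suc zero))) = refl
  G≗ (suc zero) zero = symm _ _
  G≗ (suc zero) (suc zero) = irr _
  G≗ (suc zero) (suc (suc zero)) = refl
  G≗ (suc zero) (suc (suc (suc zero))) = refl
  G≗ (suc (suc zero)) zero = symm _ _
  G≗ (suc (suc zero)) (suc zero) = symm _ _
  G≗ (suc (suc zero)) (suc (suc zero)) = irr _
  G≗ (suc (suc zero)) (suc (suc (suc zero))) = refl
  G≗ (suc (suc (suc zero))) zero = symm _ _
  G≗ (suc (suc (suc zero))) (suc zero) = symm _ _
  G≗ (suc (suc (suc zero))) (suc (suc zero)) = symm _ _
  G≗ (suc (suc (suc zero))) (suc (suc (suc zero))) = irr _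
  agree : agree₄ (c 0₄) (c 1₄) (c 2₄) (c 3₄) (G 0₄ 1₄) (G 0₄ 2₄) (G 0₄ 3₄) (G 1₄ 2₄) (G 1₄ 3₄) (G 2₄ 3₄) ≡ true
  agree =
    allCrossing-sound (c 2₄) (c 3₄) _
    (allCrossing-sound (c 1₄) (c 3₄) _
    (allCrossing-sound (c 1₄) (c 2₄) _
    (allCrossing-sound (c 0₄) (c 3₄) _
    (allCrossing-sound (c 0₄) (c 2₄) _
    (allCrossing-sound (c 0₄) (c 1₄) _
    (allBool-sound _ (allBool-sound _ (allBool-sound _ (allBool-sound _ allAgree₄-holds (c 0₄)) (c 1₄)) (c 2₄)) (c 3₄))
      (G 0₄ 1₄) (proper 0₄ 1₄)) (G 0₄ 2₄) (proper 0₄ 2₄)) (G 0₄ 3₄) (proper 0₄ 3₄))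
      (G 1₄ 2₄) (proper 1₄ 2₄)) (G 1₄ 3₄) (proper 1₄ 3₄)) (G 2₄ 3₄) (proper 2₄ 3₄)

-- Both sides satisfy the same deletion recursion with factor `+ suc N`, which is n - 4 and cancels.
-- The hypotheses are kept to those that survive the deletion of every vertex, which connectedness
-- does not.
minorSum≡4a₄ : ∀ N (G : Graph (4 ℕ.+ N)) c → IsSimple G → Proper G c → + 4 * acoef 4 G ≡ minorSum G c
minorSum≡4a₄ zero G c simple proper = minorSum≡4a₄-base G c simple proper
minorSum≡4a₄ (suc N) G c simple proper = ℤ.*-cancelˡ-≡ (+ suc N) (+ 4 * coeff (suc N) (charPoly G)) (minorSum G c) (begin
  + suc N * (+ 4 * coeff (suc N) (charPoly G))  ≡⟨ lem (+ suc N) (coeff (suc N) (charPoly G)) ⟩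
  + 4 * (+ suc N * coeff (suc N) (charPoly G))  ≡⟨ cong (+ 4 *_) (coeff-charPoly-deriv G N) ⟩
  + 4 * ∑ (λ v → coeff N (charPoly (G -ᵛ v)))   ≡⟨ sym (∑-* (+ 4) (λ v → coeff N (charPoly (G -ᵛ v)))) ⟩
  ∑ (λ v → + 4 * coeff N (charPoly (G -ᵛ v)))
    ≡⟨ ∑-cong (λ v → minorSum≡4a₄ N (G -ᵛ v) (c ∘ punchIn v) (simple-delete {G = G} v simple)
        (proper-delete {G = G} {c} v proper)) ⟩
  ∑ (λ v → minorSum (G -ᵛ v) (c ∘ punchIn v))   ≡⟨ minorSum-delete G c ⟩
  + suc N * minorSum G c ∎)
  where
  lem : ∀ n a → n * (+ 4 * a) ≡ + 4 * (n * a)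
  lem = solve-∀

-- Counting degrees

∑-nonneg : ∀ {N} {f : Fin N → ℤ} → (∀ i → + 0 ≤ f i) → + 0 ≤ ∑ f
∑-nonneg {zero} {f} 0≤f = ℤ.≤-reflexive (sym (∑-empty f))
∑-nonneg {suc N} {f} 0≤f = subst (+ 0 ≤_) (sym (∑-suc f)) (ℤ.+-mono-≤ (0≤f zero) (∑-nonneg (λ i → 0≤f (suc i))))

∑-mono : ∀ {N} {f g : Fin N → ℤ} → (∀ i → f i ≤ g i) → ∑ f ≤ ∑ g
∑-mono {zero} {f} {g} f≤g = ℤ.≤-reflexive (trans (∑-empty f) (sym (∑-empty g)))
∑-mono {suc N} {f} {g} f≤g = subst₂ _≤_ (sym (∑-suc f)) (sym (∑-suc g))
    (ℤ.+-mono-≤ (f≤g zero) (∑-mono (λ i → f≤g (suc i))))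

∑-product : ∀ {M N} (f : Fin M → ℤ) (g : Fin N → ℤ) → ∑ (λ i → ∑ λ j → f i * g j) ≡ ∑ f * ∑ g
∑-product f g = begin
  ∑ (λ i → ∑ λ j → f i * g j)  ≡⟨ ∑-cong (λ i → trans (∑-* (f i) g) (ℤ.*-comm (f i) (∑ g))) ⟩
  ∑ (λ i → ∑ g * f i)          ≡⟨ ∑-* (∑ g) f ⟩
  ∑ g * ∑ f                    ≡⟨ ℤ.*-comm (∑ g) (∑ f) ⟩
  ∑ f * ∑ g ∎

⟦⟧-idem : ∀ b → ⟦ b ⟧ * ⟦ b ⟧ ≡ ⟦ b ⟧
⟦⟧-idem true = refl
⟦⟧-idem false = refl

⟦⟧-nonneg : ∀ b → + 0 ≤ ⟦ b ⟧
⟦⟧-nonneg true = +≤+ z≤n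
⟦⟧-nonneg false = +≤+ z≤n

opaque
  *-nonneg : ∀ {i j} → + 0 ≤ i → + 0 ≤ j → + 0 ≤ i * j
  *-nonneg {+ m} {+ n} _ _ = subst (+ 0 ≤_) (ℤ.pos-* m n) (+≤+ z≤n)

size : ∀ {N} → (Fin N → Bool) → ℤ
size c = ∑ λ u → ⟦ c u ⟧

size-nonneg : ∀ {N} (c : Fin N → Bool) → + 0 ≤ size c
size-nonneg c = ∑-nonneg λ u → ⟦⟧-nonneg (c u)

size-remove : ∀ {N} (c : Fin (suc N) → Bool) u → c u ≡ true → size c ≡ + 1 + size (c ∘ punchIn u)
size-remove c u cu = trans (∑-remove u (λ v → ⟦ c v ⟧)) (cong (λ b → ⟦ b ⟧ + size (c ∘ punchIn u)) cu)

size-not : ∀ {N} (c : Fin N → Bool) → size c + size (not ∘ c) ≡ + N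
size-not {N} c = trans (sym (∑-+ (λ u → ⟦ c u ⟧) (λ u → ⟦ not (c u) ⟧))) (trans (∑-cong (λ u → one (c u))) (∑-1 N))
  where
  one : ∀ b → ⟦ b ⟧ + ⟦ not b ⟧ ≡ + 1
  one true = refl
  one false = refl

size≡0 : ∀ {N} (c : Fin N → Bool) → size c ≡ + 0 → ∀ u → c u ≡ false
size≡0 {suc N} c size≡ u with c u in cu
... | false = refl
... | true = contradiction (subst (+ 1 ≤_) (trans (sym (size-remove c u cu)) size≡)
                (ℤ.+-mono-≤ (ℤ.≤-refl {+ 1}) (size-nonneg (c ∘ punchIn u)))) λ { (+≤+ ()) }

size≢0 : ∀ {N} (c : Fin N → Bool) → size c ≢ + 0 → ∃ λ u → c u ≡ true
size≢0 c size≢ with Fin.any? (λ u → c u Bool.≟ true)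
... | yes found = found
... | no none = contradiction (∑-0 λ u → cong ⟦_⟧ (Bool.¬-not (λ cu → none (u , cu)))) size≢

record Single {N} (c : Fin N → Bool) : Set where
  field
    elem : Fin N
    elem∈ : c elem ≡ true
    unique : ∀ u → c u ≡ true → u ≡ elem
    ∑-elem : ∀ (g : Fin N → ℤ) → ∑ (λ u → ⟦ c u ⟧ * g u) ≡ g elem

record Pair {N} (c : Fin N → Bool) : Set where
  field
    fst snd : Fin N
    fst∈ : c fst ≡ true
    snd∈ : c snd ≡ true
    fst≢snd : fst ≢ snd
    ∈-cases : ∀ u → c u ≡ true → u ≡ fst ⊎ u ≡ snd
    ∑-pair : ∀ (g : Fin N → ℤ) → ∑ (λ u → ⟦ c u ⟧ * g u) ≡ g fst + g snd

+-cancel-1 : ∀ {a k} → + 1 + a ≡ + suc k → a ≡ + k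
+-cancel-1 {a} eq = trans (lem a) (cong (_+_ (- (+ 1))) eq)
  where
  lem : ∀ a → a ≡ - (+ 1) + (+ 1 + a)
  lem = solve-∀

∑-⟦⟧* : ∀ {N} (c : Fin (suc N) → Bool) u (g : Fin (suc N) → ℤ) → c u ≡ true →
  ∑ (λ v → ⟦ c v ⟧ * g v) ≡ g u + ∑ (λ v → ⟦ c (punchIn u v) ⟧ * g (punchIn u v))
∑-⟦⟧* c u g cu = trans (∑-remove u (λ v → ⟦ c v ⟧ * g v))
  (cong (λ x → x + ∑ (λ v → ⟦ c (punchIn u v) ⟧ * g (punchIn u v)))
      (trans (cong (λ b → ⟦ b ⟧ * g u) cu) (ℤ.*-identityˡ (g u))))

opaque
  size≡1 : ∀ {N} (c : Fin N → Bool) → size c ≡ + 1 → Single c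
  size≡1 {zero} c size≡ = contradiction (trans (sym size≡) (∑-empty _)) λ ()
  size≡1 {suc N} c size≡ with size≢0 c (λ size≡0 → contradiction (trans (sym size≡) size≡0) λ ())
  ... | u , cu = record
    { elem = u ; elem∈ = cu
    ; unique = only
    ; ∑-elem = λ g → trans (∑-⟦⟧* c u g cu) (trans (cong (_+_ (g u))
        (∑-0 λ v → cong (λ b → ⟦ b ⟧ * g (punchIn u v)) (size≡0 (c ∘ punchIn u) rest v))) (ℤ.+-identityʳ (g u))) }
    where
    rest : size (c ∘ punchIn u) ≡ + 0
    rest = +-cancel-1 (trans (sym (size-remove c u cu)) size≡)
    only : ∀ v → c v ≡ true → v ≡ u
    only v cv with u Fin.≟ v
    ... | yes u≡v = sym u≡v
    ... | no u≢v = contradiction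
      (trans (sym cv) (trans (cong c (sym (Fin.punchIn-punchOut u≢v))) (size≡0 (c ∘ punchIn u) rest (punchOut u≢v)))) λ ()

  size≡2 : ∀ {N} (c : Fin N → Bool) → size c ≡ + 2 → Pair c
  size≡2 {zero} c size≡ = contradiction (trans (sym size≡) (∑-empty _)) λ ()
  size≡2 {suc N} c size≡ with size≢0 c (λ size≡0 → contradiction (trans (sym size≡) size≡0) λ ())
  ... | u , cu = record
    { fst = u ; snd = w ; fst∈ = cu ; snd∈ = elem∈
    ; fst≢snd = Fin.punchInᵢ≢i u elem ∘ sym
    ; ∈-cases = cases
    ; ∑-pair = λ g → trans (∑-⟦⟧* c u g cu) (cong (_+_ (g u)) (∑-elem (g ∘ punchIn u))) }
    where
    rest : size (c ∘ punchIn u) ≡ + 1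
    rest = +-cancel-1 (trans (sym (size-remove c u cu)) size≡)
    open Single (size≡1 (c ∘ punchIn u) rest)
    w : Fin (suc N)
    w = punchIn u elem
    cases : ∀ v → c v ≡ true → v ≡ u ⊎ v ≡ w
    cases v cv with u Fin.≟ v
    ... | yes u≡v = inj₁ (sym u≡v)
    ... | no u≢v = inj₂ (trans (sym (Fin.punchIn-punchOut u≢v))
      (cong (punchIn u) (unique (punchOut u≢v) (trans (cong c (Fin.punchIn-punchOut u≢v)) cv))))

deg : ∀ {N} → Graph N → Fin N → ℤ
deg G u = size (G u)

codeg : ∀ {N} → Graph N → Fin N → Fin N → ℤ
codeg G u v = ∑ λ w → ⟦ G u w ⟧ * ⟦ G v w ⟧

crossEdges : ∀ {N} → Graph N → Coloring N → ℤ
crossEdges G c = ∑ λ u → ⟦ c u ⟧ * deg G u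

codegSum : ∀ {N} → Graph N → Coloring N → ℤ
codegSum G c = ∑ λ a → ∑ λ b → ⟦ c a ⟧ * ⟦ c b ⟧ * (codeg G a b * codeg G a b)

same-color : ∀ {N} {G : Graph N} {c} → Proper G c → ∀ {u v} → c u ≡ c v → G u v ≡ false
same-color {G = G} proper {u} {v} cu≡cv with G u v in uv
... | false = refl
... | true = contradiction cu≡cv (proper u v uv)

-- Lagrange's identity for two 0/1 rows: their squared minors sum to 2 (deg a deg b - codeg(a,b)²)
-- over ordered pairs of columns. Summing over `a` and `b` turns the first term into the square of
-- the number of edges.
minorSum-expand : ∀ {N} (G : Graph N) c → Proper G c →
  minorSum G c ≡ + 2 * (crossEdges G c * crossEdges G c) - + 2 * codegSum G c
minorSum-expand {N} G c proper = begin
  ∑₄ (quad G c)                                   ≡⟨ ∑₄-cong pointwise ⟩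
  ∑₄ (λ a b x y → t₁ a b x y + (t₂ a b x y + - (+ 2) * t₃ a b x y))
    ≡⟨ (∑-cong λ a → ∑-cong λ b → begin
      ∑ (λ x → ∑ λ y → t₁ a b x y + (t₂ a b x y + - (+ 2) * t₃ a b x y))
        ≡⟨ ∑∑-+ (t₁ a b) (λ x y → t₂ a b x y + - (+ 2) * t₃ a b x y) ⟩
      ∑ (λ x → ∑ (t₁ a b x)) + ∑ (λ x → ∑ λ y → t₂ a b x y + - (+ 2) * t₃ a b x y)
        ≡⟨ cong₂ _+_ (prod (χ a * χ b) (e a) (e b)) (trans (∑∑-+ (t₂ a b) (λ x y → - (+ 2) * t₃ a b x y))
             (cong₂ _+_ (prod (χ a * χ b) (e b) (e a)) (trans (∑∑-* (- (+ 2)) (t₃ a b))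
               (cong (- (+ 2) *_) (prod (χ a * χ b) (λ x → e a x * e b x) (λ y → e a y * e b y)))))) ⟩
      χ a * χ b * (deg G a * deg G b) + (χ a * χ b * (deg G b * deg G a) + - (+ 2) *
          (χ a * χ b * (codeg G a b * codeg G a b)))
        ≡⟨ lem₁ (χ a) (χ b) (deg G a) (deg G b) (codeg G a b * codeg G a b) ⟩
      + 2 * ((χ a * deg G a) * (χ b * deg G b)) + - (+ 2) * k a b ∎) ⟩
  ∑ (λ a → ∑ λ b → + 2 * ((χ a * deg G a) * (χ b * deg G b)) + - (+ 2) * k a b)
    ≡⟨ ∑∑-+ (λ a b → + 2 * ((χ a * deg G a) * (χ b * deg G b))) (λ a b → - (+ 2) * k a b) ⟩
  ∑ (λ a → ∑ λ b → + 2 * ((χ a * deg G a) * (χ b * deg G b))) + ∑ (λ a → ∑ λ b → - (+ 2) * k a b)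
    ≡⟨ cong₂ _+_
         (trans (∑∑-* (+ 2) (λ a b → (χ a * deg G a) * (χ b * deg G b)))
                (cong (+ 2 *_) (∑-product (λ a → χ a * deg G a) (λ b → χ b * deg G b))))
         (∑∑-* (- (+ 2)) k) ⟩
  + 2 * (crossEdges G c * crossEdges G c) + - (+ 2) * codegSum G c  ≡⟨ lem₂ (crossEdges G c * crossEdges G c)
      (codegSum G c) ⟩
  + 2 * (crossEdges G c * crossEdges G c) - + 2 * codegSum G c ∎
  where
  χ : Fin N → ℤ
  χ u = ⟦ c u ⟧
  e : Fin N → Fin N → ℤ
  e u v = ⟦ G u v ⟧
  t₁ t₂ t₃ : Fin N → Fin N → Fin N → Fin N → ℤ
  t₁ a b x y = χ a * χ b * (e a x * e b y)
  t₂ a b x y = χ a * χ b * (e b x * e a y)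
  t₃ a b x y = χ a * χ b * ((e a x * e b x) * (e a y * e b y))
  k : Fin N → Fin N → ℤ
  k a b = χ a * χ b * (codeg G a b * codeg G a b)
  lem₁ : ∀ p q d f k → p * q * (d * f) + (p * q * (f * d) + - (+ 2) * (p * q * k)) ≡ + 2 * ((p * d) * (q * f)) + -
      (+ 2) * (p * q * k)
  lem₁ = solve-∀
  lem₂ : ∀ m k → + 2 * m + - (+ 2) * k ≡ + 2 * m - + 2 * k
  lem₂ = solve-∀
  ∑∑-+ : (f g : Fin N → Fin N → ℤ) → ∑ (λ x → ∑ λ y → f x y + g x y) ≡ ∑ (λ x → ∑ (f x)) + ∑ (λ x → ∑ (g x))
  ∑∑-+ f g = trans (∑-cong λ x → ∑-+ (f x) (g x)) (∑-+ (λ x → ∑ (f x)) (λ x → ∑ (g x)))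
  ∑∑-* : ∀ k (f : Fin N → Fin N → ℤ) → ∑ (λ x → ∑ λ y → k * f x y) ≡ k * ∑ (λ x → ∑ (f x))
  ∑∑-* k f = trans (∑-cong λ x → ∑-* k (f x)) (∑-* k (λ x → ∑ (f x)))
  prod : ∀ k (f g : Fin N → ℤ) → ∑ (λ x → ∑ λ y → k * (f x * g y)) ≡ k * (∑ f * ∑ g)
  prod k f g = trans (∑∑-* k (λ x y → f x * g y)) (cong (k *_) (∑-product f g))
  pointwise : ∀ a b x y → quad G c a b x y ≡
    χ a * χ b * (e a x * e b y) + (χ a * χ b * (e b x * e a y) + - (+ 2) *
        (χ a * χ b * ((e a x * e b x) * (e a y * e b y))))
  -- For a column of the rows' own colour the entries are zero, so on the right the columns may
  -- range over all vertices.
  pointwise a b x y with c a in ca | c b in cb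
  ... | false | _ = refl
  ... | true | false = refl
  ... | true | true with c x in cx
  ... | true rewrite same-color {G = G} proper (trans ca (sym cx)) | same-color {G = G} proper (trans cb (sym cx)) = refl
  ... | false with c y in cy
  ... | true rewrite same-color {G = G} proper (trans ca (sym cy)) | same-color {G = G} proper (trans cb (sym cy))
      | ℤ.*-zeroʳ ⟦ G a x ⟧ | ℤ.*-zeroʳ ⟦ G b x ⟧ | ℤ.*-zeroʳ (⟦ G a x ⟧ * ⟦ G b x ⟧) = refl
  ... | false = bits (G a x) (G b y) (G a y) (G b x)
    where
    bits : ∀ p q r s → + 1 * ((⟦ p ⟧ * ⟦ q ⟧ - ⟦ r ⟧ * ⟦ s ⟧) * (⟦ p ⟧ * ⟦ q ⟧ - ⟦ r ⟧ * ⟦ s ⟧)) ≡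
      + 1 * (⟦ p ⟧ * ⟦ q ⟧) + (+ 1 * (⟦ s ⟧ * ⟦ r ⟧) + - (+ 2) * (+ 1 * ((⟦ p ⟧ * ⟦ s ⟧) * (⟦ r ⟧ * ⟦ q ⟧))))
    bits true true true true = refl
    bits true true true false = refl
    bits true true false true = refl
    bits true true false false = refl
    bits true false true true = refl
    bits true false true false = refl
    bits true false false true = refl
    bits true false false false = refl
    bits false true true true = refl
    bits false true true false = refl
    bits false true false true = refl
    bits false true false false = refl
    bits false false true true = refl
    bits false false true false = refl
    bits false false false true = refl
    bits false false false false = refl

pos-finSum : ∀ N (f : Fin N → ℕ) → + finSum ℕ._+_ 0 N f ≡ ∑ (λ i → + f i)
pos-finSum zero f = sym (∑-empty (λ i → + f i))
pos-finSum (suc N) f = begin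
  + finSum ℕ._+_ 0 (suc N) f                  ≡⟨ cong +_ (finSum-suc ℕ._+_ 0 N f) ⟩
  + (f zero ℕ.+ finSum ℕ._+_ 0 N (f ∘ suc))   ≡⟨ ℤ.pos-+ (f zero) (finSum ℕ._+_ 0 N (f ∘ suc)) ⟩
  + f zero + + finSum ℕ._+_ 0 N (f ∘ suc)     ≡⟨ cong (_+_ (+ f zero)) (pos-finSum N (f ∘ suc)) ⟩
  + f zero + ∑ (λ i → + f (suc i))            ≡⟨ sym (∑-suc (λ i → + f i)) ⟩
  ∑ (λ i → + f i) ∎

<ᵇ-total : ∀ m n → m ≢ n → ⟦ m <ᵇ n ⟧ + ⟦ n <ᵇ m ⟧ ≡ + 1
<ᵇ-total zero zero m≢n = contradiction refl m≢n
<ᵇ-total zero (suc n) m≢n = refl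
<ᵇ-total (suc m) zero m≢n = refl
<ᵇ-total (suc m) (suc n) m≢n = <ᵇ-total m n (m≢n ∘ cong suc)

proper-not : ∀ {N} {G : Graph N} {c} → Proper G c → Proper G (not ∘ c)
proper-not proper u v uv eq = proper u v uv (Bool.not-injective eq)

-- Each edge is counted once, at u < v, and is charged to its end coloured `true`: this is the
-- smaller end in `A` and the larger one in `B`.
edgeCount≡crossEdges : ∀ {N} (G : Graph N) c → IsSimple G → Proper G c → + edgeCount G ≡ crossEdges G c
edgeCount≡crossEdges {N} G c (symm , irr) proper = begin
  + edgeCount G  ≡⟨ trans (pos-finSum N _) (∑-cong λ u → trans (pos-finSum N _) (∑-cong λ v → ordered u v)) ⟩
  ∑ (λ u → ∑ λ v → A u v + B v u)
    ≡⟨ trans (∑-cong λ u → ∑-+ (A u) (λ v → B v u)) (∑-+ (λ u → ∑ (A u)) (λ u → ∑ (λ v → B v u))) ⟩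
  ∑ (λ u → ∑ (A u)) + ∑ (λ u → ∑ (λ v → B v u))   ≡⟨ cong (_+_ (∑ (λ u → ∑ (A u)))) (∑-swap (λ u v → B v u)) ⟩
  ∑ (λ u → ∑ (A u)) + ∑ (λ u → ∑ (B u))           ≡⟨ sym (∑-+ (λ u → ∑ (A u)) (λ u → ∑ (B u))) ⟩
  ∑ (λ u → ∑ (A u) + ∑ (B u))                     ≡⟨ (∑-cong λ u → sym (∑-+ (A u) (B u))) ⟩
  ∑ (λ u → ∑ λ v → A u v + B u v)                 ≡⟨ (∑-cong λ u → trans (∑-cong λ v → split u v)
      (∑-* ⟦ c u ⟧ (λ v → ⟦ G u v ⟧))) ⟩
  crossEdges G c ∎
  where
  A B : Fin N → Fin N → ℤ
  A u v = ⟦ c u ⟧ * (⟦ G u v ⟧ * ⟦ toℕ u <ᵇ toℕ v ⟧)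
  B u v = ⟦ c u ⟧ * (⟦ G u v ⟧ * ⟦ toℕ v <ᵇ toℕ u ⟧)
  split : ∀ u v → A u v + B u v ≡ ⟦ c u ⟧ * ⟦ G u v ⟧
  split u v with G u v in uv
  ... | false = lem ⟦ c u ⟧
    where
    lem : ∀ x → x * + 0 + x * + 0 ≡ x * + 0
    lem = solve-∀
  ... | true = trans (lem ⟦ c u ⟧ ⟦ toℕ u <ᵇ toℕ v ⟧ ⟦ toℕ v <ᵇ toℕ u ⟧)
      (cong (⟦ c u ⟧ *_) (<ᵇ-total (toℕ u) (toℕ v) (u≢v ∘ Fin.toℕ-injective)))
    where
    u≢v : u ≢ v
    u≢v refl = contradiction (trans (sym uv) (irr u)) λ ()
    lem : ∀ x y z → x * (+ 1 * y) + x * (+ 1 * z) ≡ x * (y + z)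
    lem = solve-∀
  ordered : ∀ u v → + (if G u v ∧ (toℕ u <ᵇ toℕ v) then 1 else 0) ≡ A u v + B v u
  ordered u v rewrite symm v u with G u v in uv | toℕ u <ᵇ toℕ v
  ... | false | l = lem ⟦ c u ⟧ ⟦ c v ⟧
    where
    lem : ∀ x y → + 0 ≡ x * + 0 + y * + 0
    lem = solve-∀
  ... | true | false = lem ⟦ c u ⟧ ⟦ c v ⟧
    where
    lem : ∀ x y → + 0 ≡ x * + 0 + y * + 0
    lem = solve-∀
  ... | true | true with c u | c v | proper u v uv
  ... | true | true | cu≢cv = contradiction refl cu≢cv
  ... | true | false | cu≢cv = refl
  ... | false | true | cu≢cv = refl
  ... | false | false | cu≢cv = contradiction refl cu≢cv

neighbour : ∀ {N} {G : Graph N} → Connected G → ∀ {u v} → u ≢ v → ∃ λ w → G u w ≡ true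
neighbour connected {u} {v} u≢v with connected u v
... | here = contradiction refl u≢v
... | step {w = w} uw _ = w , uw

size≥1 : ∀ {N} (c : Fin N → Bool) u → c u ≡ true → + 1 ≤ size c
size≥1 {suc N} c u cu = subst (+ 1 ≤_) (sym (size-remove c u cu))
    (ℤ.+-mono-≤ (ℤ.≤-refl {+ 1}) (size-nonneg (c ∘ punchIn u)))

opposite : ∀ {N} {G : Graph N} {c} → Proper G c → ∀ {u v} → G u v ≡ true → c v ≡ not (c u)
opposite {c = c} proper {u} {v} uv with c u | c v | proper u v uv
... | true | true | ne = contradiction refl ne
... | true | false | ne = refl
... | false | true | ne = refl
... | false | false | ne = contradiction refl ne

-- A class of two vertices, and graphs of minimum degree two

record Bipartition {N} (G : Graph N) (c : Coloring N) : Set where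
  constructor bipartition
  field
    simple : IsSimple G
    proper : Proper G c
  symmetric : ∀ u v → G u v ≡ G v u
  symmetric = proj₁ simple

pair-crossEdges : ∀ {N} (G : Graph N) {c} (P : Pair c) → crossEdges G c ≡ deg G (Pair.fst P) + deg G (Pair.snd P)
pair-crossEdges G P = Pair.∑-pair P (deg G)

-- With no isolated vertex the neighbourhoods of the pair cover the other class, so deg a + deg b =
-- q + k with k the codegree. Then k = M - q, and the expansion of the minor sum depends on q, k and
-- deg a alone.
minorSum-pair : ∀ {N} (G : Graph N) c → Bipartition G c → (∀ u → ∃ λ w → G u w ≡ true) → (P : Pair c) →
  let M = crossEdges G c; q = size (not ∘ c) in
  minorSum G c ≡ + 4 * ((M - q) * (+ 2 * q - M) + (q - deg G (Pair.fst P)) * (q - deg G (Pair.snd P)))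
minorSum-pair {N} G c (bipartition (symm , _) proper) nonisolated P = begin
  minorSum G c                                            ≡⟨ minorSum-expand G c proper ⟩
  + 2 * (M * M) - + 2 * codegSum G c
    ≡⟨ cong₂ (λ x y → + 2 * (x * x) - + 2 * y) (trans (pair-crossEdges G P) degs) codegs ⟩
  + 2 * ((q + k) * (q + k)) - + 2 * (da * da + k * k + (k * k + db * db))
    ≡⟨ cong (λ x → + 2 * ((q + k) * (q + k)) - + 2 * (da * da + k * k + (k * k + x * x))) db≡ ⟩
  + 2 * ((q + k) * (q + k)) - + 2 * (da * da + k * k + (k * k + (q + k - da) * (q + k - da)))
    ≡⟨ lem q k da ⟩
  + 4 * (((q + k) - q) * (+ 2 * q - (q + k)) + (q - da) * (q - (q + k - da)))
    ≡⟨ cong₂ (λ x y → + 4 * ((x - q) * (+ 2 * q - x) + (q - da) * (q - y))) (sym (trans (pair-crossEdges G P) degs))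
        (sym db≡) ⟩
  + 4 * ((M - q) * (+ 2 * q - M) + (q - da) * (q - db)) ∎
  where
  open Pair P renaming (fst to a; snd to b; fst∈ to ca; snd∈ to cb)
  M = crossEdges G c
  q = size (not ∘ c)
  da = deg G a
  db = deg G b
  k = codeg G a b
  e : Fin N → Fin N → ℤ
  e u v = ⟦ G u v ⟧
  cover : ∀ y → e a y + e b y ≡ ⟦ not (c y) ⟧ + e a y * e b y
  cover y with c y in cy
  ... | true rewrite same-color {G = G} proper (trans ca (sym cy)) | same-color {G = G} proper (trans cb (sym cy)) = refl
  ... | false with nonisolated y
  ... | w , yw with ∈-cases w (trans (opposite {G = G} proper yw) (cong not cy))
  ... | inj₁ refl rewrite trans (symm a y) yw = lem′ ⟦ G b y ⟧
    where
    lem′ : ∀ x → + 1 + x ≡ + 1 + + 1 * x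
    lem′ = solve-∀
  ... | inj₂ refl rewrite trans (symm b y) yw = lem′ ⟦ G a y ⟧
    where
    lem′ : ∀ x → x + + 1 ≡ + 1 + x * + 1
    lem′ = solve-∀
  degs : da + db ≡ q + k
  degs = begin
    da + db                             ≡⟨ sym (∑-+ (e a) (e b)) ⟩
    ∑ (λ y → e a y + e b y)             ≡⟨ ∑-cong cover ⟩
    ∑ (λ y → ⟦ not (c y) ⟧ + e a y * e b y) ≡⟨ ∑-+ (λ y → ⟦ not (c y) ⟧) (λ y → e a y * e b y) ⟩
    q + k ∎
  db≡ : db ≡ q + k - da
  db≡ = trans (lem′ da db) (cong (_- da) degs)
    where
    lem′ : ∀ x y → y ≡ x + y - x
    lem′ = solve-∀
  codeg-self : ∀ u → codeg G u u ≡ deg G u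
  codeg-self u = ∑-cong λ w → ⟦⟧-idem (G u w)
  κ : Fin N → Fin N → ℤ
  κ u v = codeg G u v * codeg G u v
  codegs : codegSum G c ≡ da * da + k * k + (k * k + db * db)
  codegs = begin
    ∑ (λ u → ∑ λ v → ⟦ c u ⟧ * ⟦ c v ⟧ * κ u v)
      ≡⟨ (∑-cong λ u → trans (∑-cong λ v → ℤ.*-assoc ⟦ c u ⟧ ⟦ c v ⟧ (κ u v)) (∑-* ⟦ c u ⟧ (λ v → ⟦ c v ⟧ * κ u v))) ⟩
    ∑ (λ u → ⟦ c u ⟧ * ∑ (λ v → ⟦ c v ⟧ * κ u v))
      ≡⟨ ∑-pair (λ u → ∑ (λ v → ⟦ c v ⟧ * κ u v)) ⟩
    ∑ (λ v → ⟦ c v ⟧ * κ a v) + ∑ (λ v → ⟦ c v ⟧ * κ b v)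
      ≡⟨ cong₂ _+_ (∑-pair (κ a)) (∑-pair (κ b)) ⟩
    κ a a + κ a b + (κ b a + κ b b)
      ≡⟨ cong₂ _+_ (cong (λ x → x * x + κ a b) (codeg-self a))
           (cong₂ (λ x y → x * x + y * y) (∑-cong λ w → ℤ.*-comm (e b w) (e a w)) (codeg-self b)) ⟩
    da * da + k * k + (k * k + db * db) ∎
  lem : ∀ q k d → + 2 * ((q + k) * (q + k)) - + 2 * (d * d + k * k + (k * k + (q + k - d) * (q + k - d)))
    ≡ + 4 * (((q + k) - q) * (+ 2 * q - (q + k)) + (q - d) * (q - (q + k - d)))
  lem = solve-∀

-- Every nonedge between the classes lies, with a neighbour of each of its ends, in a 2 × 2 submatrix of
-- determinant ±1, and such a submatrix contains at most two nonedges in this way.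
minorSum-nonedges : ∀ {N} (G : Graph N) c → Bipartition G c → (∀ u → + 2 ≤ deg G u) →
  + 8 * (size c * size (not ∘ c) - crossEdges G c) ≤ minorSum G c
minorSum-nonedges {N} G c (bipartition (symm , _) proper) deg≥2 = ℤ.≤-trans lower upper
  where
  e : Fin N → Fin N → ℤ
  e u v = ⟦ G u v ⟧
  -- The indicator of a nonedge a y between the classes; `W` counts these together with a neighbour
  -- x of a and a neighbour b of y.
  h : Fin N → Fin N → ℤ
  h a y = ⟦ c a ⟧ * ⟦ not (c y) ⟧ * (+ 1 - e a y)
  W : ℤ
  W = ∑ λ a → ∑ λ y → h a y * (deg G a * deg G y)
  f g : Fin N → Fin N → Fin N → Fin N → ℤ
  f a b x y = h a y * (e a x * e y b)
  g a b x y = h a x * (e a y * e x b)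
  -- A nonzero `f` needs the edge a x and a nonzero `g` its absence, so at most one of them is 1;
  -- one product in the minor is then 1 and the other 0.
  pointwise : ∀ a b x y → f a b x y + g a b x y ≤ quad G c a b x y
  pointwise a b x y rewrite symm y b | symm x b =
    claim (c a) (c b) (c x) (c y) (G a x) (G b y) (G a y) (G b x)
      (same-color {G = G} proper) (same-color {G = G} proper) (same-color {G = G} proper) (same-color {G = G} proper)
    where
    claim : ∀ ca cb cx cy p q r s → (ca ≡ cx → p ≡ false) → (cb ≡ cy → q ≡ false) → (ca ≡ cy → r ≡ false) →
        (cb ≡ cx → s ≡ false) →
      ⟦ ca ⟧ * ⟦ not cy ⟧ * (+ 1 - ⟦ r ⟧) * (⟦ p ⟧ * ⟦ q ⟧) + ⟦ ca ⟧ * ⟦ not cx ⟧ * (+ 1 - ⟦ p ⟧) * (⟦ r ⟧ * ⟦ s ⟧) ≤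
      ⟦ ca ⟧ * ⟦ cb ⟧ * (⟦ not cx ⟧ * ⟦ not cy ⟧) * ((⟦ p ⟧ * ⟦ q ⟧ - ⟦ r ⟧ * ⟦ s ⟧) * (⟦ p ⟧ * ⟦ q ⟧ - ⟦ r ⟧ * ⟦ s ⟧))
    claim false cb cx cy p q r s _ _ _ _ = +≤+ z≤n
    claim true true true true p q r s _ _ _ _ = +≤+ z≤n
    claim true true true false true q r s hp _ _ _ = contradiction (hp refl) λ ()
    claim true true true false false q true s _ _ _ _ = +≤+ z≤n
    claim true true true false false q false s _ _ _ _ = +≤+ z≤n
    claim true true false true p q true s _ _ hr _ = contradiction (hr refl) λ ()
    claim true true false true true q false s _ _ _ _ = +≤+ z≤n
    claim true true false true false q false s _ _ _ _ = +≤+ z≤n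
    claim true false true true p q r s _ _ _ _ = +≤+ z≤n
    claim true false true false true q r s hp _ _ _ = contradiction (hp refl) λ ()
    claim true false true false false q true s _ _ _ _ = +≤+ z≤n
    claim true false true false false q false s _ _ _ _ = +≤+ z≤n
    claim true false false true p q true s _ _ hr _ = contradiction (hr refl) λ ()
    claim true false false true true q false s _ _ _ _ = +≤+ z≤n
    claim true false false true false q false s _ _ _ _ = +≤+ z≤n
    claim true false false false p true r s _ hq _ _ = contradiction (hq refl) λ ()
    claim true false false false p false r true _ _ _ hs = contradiction (hs refl) λ ()
    claim true false false false true false true false _ _ _ _ = +≤+ z≤n
    claim true false false false true false false false _ _ _ _ = +≤+ z≤n
    claim true false false false false false true false _ _ _ _ = +≤+ z≤n
    claim true false false false false false false false _ _ _ _ = +≤+ z≤n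
    claim true true false false true true true true _ _ _ _ = +≤+ z≤n
    claim true true false false true true true false _ _ _ _ = +≤+ z≤n
    claim true true false false true true false true _ _ _ _ = +≤+ (s≤s z≤n)
    claim true true false false true true false false _ _ _ _ = +≤+ (s≤s z≤n)
    claim true true false false true false true true _ _ _ _ = +≤+ z≤n
    claim true true false false true false true false _ _ _ _ = +≤+ z≤n
    claim true true false false true false false true _ _ _ _ = +≤+ z≤n
    claim true true false false true false false false _ _ _ _ = +≤+ z≤n
    claim true true false false false true true true _ _ _ _ = +≤+ (s≤s z≤n)
    claim true true false false false true true false _ _ _ _ = +≤+ z≤n
    claim true true false false false true false true _ _ _ _ = +≤+ z≤n
    claim true true false false false true false false _ _ _ _ = +≤+ z≤n
    claim true true false false false false true true _ _ _ _ = +≤+ (s≤s z≤n)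
    claim true true false false false false true false _ _ _ _ = +≤+ z≤n
    claim true true false false false false false true _ _ _ _ = +≤+ z≤n
    claim true true false false false false false false _ _ _ _ = +≤+ z≤n
  ∑f : ∑₄ f ≡ W
  ∑f = begin
    ∑ (λ a → ∑ λ b → ∑ λ x → ∑ λ y → h a y * (e a x * e y b))
      ≡⟨ (∑-cong λ a → ∑-cong λ b → ∑-swap (f a b)) ⟩
    ∑ (λ a → ∑ λ b → ∑ λ y → ∑ λ x → h a y * (e a x * e y b))
      ≡⟨ (∑-cong λ a → ∑-swap (λ b y → ∑ λ x → f a b x y)) ⟩
    ∑ (λ a → ∑ λ y → ∑ λ b → ∑ λ x → h a y * (e a x * e y b))
      ≡⟨ (∑-cong λ a → ∑-cong λ y → trans (∑-swap (λ b x → f a b x y))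
           (trans (∑-cong λ x → ∑-* (h a y) (λ b → e a x * e y b))
           (trans (∑-* (h a y) (λ x → ∑ λ b → e a x * e y b)) (cong (h a y *_) (∑-product (e a) (e y)))))) ⟩
    W ∎
  ∑g : ∑₄ g ≡ W
  ∑g = trans (∑-cong λ a → ∑-cong λ b → ∑-swap (g a b)) ∑f
  upper : + 2 * W ≤ minorSum G c
  upper = subst (_≤ minorSum G c) total
    (∑-mono λ a → ∑-mono λ b → ∑-mono λ x → ∑-mono λ y → pointwise a b x y)
    where
    double : ∀ w → w + w ≡ + 2 * w
    double = solve-∀
    total : ∑₄ (λ a b x y → f a b x y + g a b x y) ≡ + 2 * W
    total = begin
      ∑₄ (λ a b x y → f a b x y + g a b x y)
        ≡⟨ (∑-cong λ a → trans (∑-cong λ b → trans (∑-cong λ x → ∑-+ (f a b x) (g a b x))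
             (∑-+ (λ x → ∑ (f a b x)) (λ x → ∑ (g a b x))))
                 (∑-+ (λ b → ∑ λ x → ∑ (f a b x)) (λ b → ∑ λ x → ∑ (g a b x)))) ⟩
      ∑ (λ a → (∑ λ b → ∑ λ x → ∑ (f a b x)) + (∑ λ b → ∑ λ x → ∑ (g a b x)))
        ≡⟨ ∑-+ (λ a → ∑ λ b → ∑ λ x → ∑ (f a b x)) (λ a → ∑ λ b → ∑ λ x → ∑ (g a b x)) ⟩
      ∑₄ f + ∑₄ g  ≡⟨ cong₂ _+_ ∑f ∑g ⟩
      W + W        ≡⟨ double W ⟩
      + 2 * W ∎
  nonedges : ∑ (λ a → ∑ (h a)) ≡ size c * size (not ∘ c) - crossEdges G c
  nonedges = begin
    ∑ (λ a → ∑ (h a))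
      ≡⟨ (∑-cong λ a → trans (∑-cong λ y → count a y) (trans
          (∑-+ (λ y → ⟦ c a ⟧ * ⟦ not (c y) ⟧) (λ y → - ⟦ c a ⟧ * e a y))
           (cong (_+_ (∑ (λ y → ⟦ c a ⟧ * ⟦ not (c y) ⟧))) (trans (∑-* (- ⟦ c a ⟧) (e a)) (neg ⟦ c a ⟧ (deg G a)))))) ⟩
    ∑ (λ a → ∑ (λ y → ⟦ c a ⟧ * ⟦ not (c y) ⟧) + - (+ 1) * (⟦ c a ⟧ * deg G a))
      ≡⟨ ∑-+ (λ a → ∑ (λ y → ⟦ c a ⟧ * ⟦ not (c y) ⟧)) (λ a → - (+ 1) * (⟦ c a ⟧ * deg G a)) ⟩
    ∑ (λ a → ∑ (λ y → ⟦ c a ⟧ * ⟦ not (c y) ⟧)) + ∑ (λ a → - (+ 1) * (⟦ c a ⟧ * deg G a))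
      ≡⟨ cong₂ _+_ (∑-product (λ a → ⟦ c a ⟧) (λ y → ⟦ not (c y) ⟧)) (∑-* (- (+ 1)) (λ a → ⟦ c a ⟧ * deg G a)) ⟩
    size c * size (not ∘ c) + - (+ 1) * crossEdges G c  ≡⟨ minus (size c * size (not ∘ c)) (crossEdges G c) ⟩
    size c * size (not ∘ c) - crossEdges G c ∎
    where
    neg : ∀ x d → - x * d ≡ - (+ 1) * (x * d)
    neg = solve-∀
    minus : ∀ x y → x + - (+ 1) * y ≡ x - y
    minus = solve-∀
    count : ∀ a y → h a y ≡ ⟦ c a ⟧ * ⟦ not (c y) ⟧ + - ⟦ c a ⟧ * e a y
    count a y with c a in ca | c y in cy
    ... | false | _ = refl
    ... | true | true rewrite same-color {G = G} proper (trans ca (sym cy)) = refl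
    ... | true | false with G a y
    ... | true = refl
    ... | false = refl
  lower : + 8 * (size c * size (not ∘ c) - crossEdges G c) ≤ + 2 * W
  lower = subst (_≤ + 2 * W) (trans (scale (∑ λ a → ∑ (h a))) (cong (+ 8 *_) nonedges))
    (ℤ.*-monoˡ-≤-nonNeg (+ 2) (subst (_≤ W) (trans (∑-cong λ a → ∑-* (+ 4) (h a)) (∑-* (+ 4) (λ a → ∑ (h a))))
      (∑-mono λ a → ∑-mono λ y → weight a y)))
    where
    scale : ∀ x → + 2 * (+ 4 * x) ≡ + 8 * x
    scale = solve-∀
    h≥0 : ∀ a y → + 0 ≤ h a y
    h≥0 a y with c a | c y | G a y
    ... | true | true | true = +≤+ z≤n
    ... | true | true | false = +≤+ z≤n
    ... | true | false | true = +≤+ z≤n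
    ... | true | false | false = +≤+ z≤n
    ... | false | _ | _ = +≤+ z≤n
    -- Both degrees are at least 2, so each nonedge is completed in at least 4 ways; with W taken
    -- once for `f` and once for `g` this makes the constant 8.
    weight : ∀ a y → + 4 * h a y ≤ h a y * (deg G a * deg G y)
    weight a y = ℤ.0≤i-j⇒j≤i (subst (+ 0 ≤_) (lem (h a y) (deg G a) (deg G y))
      (*-nonneg (h≥0 a y) (ℤ.+-mono-≤ (ℤ.+-mono-≤ (*-nonneg (pos a) (pos y)) (*-nonneg {+ 2} (+≤+ z≤n) (pos a)))
          (*-nonneg {+ 2} (+≤+ z≤n) (pos y)))))
      where
      pos : ∀ u → + 0 ≤ deg G u - + 2
      pos u = ℤ.i≤j⇒0≤j-i (deg≥2 u)
      lem : ∀ h d k → h * ((d - + 2) * (k - + 2) + + 2 * (d - + 2) + + 2 * (k - + 2)) ≡ h * (d * k) - + 4 * h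
      lem = solve-∀

-- Deleting a leaf

module _ {N} (G : Graph (suc N)) (symm : ∀ u v → G u v ≡ G v u) (v : Fin (suc N)) (w : Fin N)
         (only : ∀ u → G v u ≡ true → u ≡ punchIn v w) where

  -- Folding the leaf `v` onto its neighbour sends each edge to an edge or to a single vertex, so
  -- walks of the graph become walks that avoid `v`.
  retract : Fin (suc N) → Fin N
  retract x with v Fin.≟ x
  ... | yes _ = w
  ... | no v≢x = punchOut v≢x

  punchIn-retract : ∀ x → v ≢ x → punchIn v (retract x) ≡ x
  punchIn-retract x v≢x with v Fin.≟ x
  ... | yes v≡x = contradiction v≡x v≢x
  ... | no v≢x = Fin.punchIn-punchOut v≢x

  retract-punchIn : ∀ x → retract (punchIn v x) ≡ x
  retract-punchIn x = Fin.punchIn-injective v _ _ (punchIn-retract (punchIn v x) (Fin.punchInᵢ≢i v x ∘ sym))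

  retract-edge : ∀ x z → G x z ≡ true → retract x ≡ retract z ⊎ (G -ᵛ v) (retract x) (retract z) ≡ true
  retract-edge x z xz with v Fin.≟ x
  ... | yes refl = inj₁ (sym (trans (cong retract (only z xz)) (retract-punchIn w)))
  ... | no v≢x with v Fin.≟ z
  ... | yes refl = inj₁ (Fin.punchIn-injective v _ _ (trans (Fin.punchIn-punchOut v≢x) (only x (trans (symm v x) xz))))
  ... | no v≢z = inj₂ (trans (cong₂ G (Fin.punchIn-punchOut v≢x) (Fin.punchIn-punchOut v≢z)) xz)

  retract-reach : ∀ {x y} → Reach G x y → Reach (G -ᵛ v) (retract x) (retract y)
  retract-reach here = here
  retract-reach {y = y} (step {u = x} {w = z} xz zy) with retract-edge x z xz
  ... | inj₁ eq = subst (λ r → Reach (G -ᵛ v) r (retract y)) (sym eq) (retract-reach zy)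
  ... | inj₂ e = step e (retract-reach zy)

  leaf-connected : Connected G → Connected (G -ᵛ v)
  leaf-connected connected a b = subst₂ (Reach (G -ᵛ v)) (retract-punchIn a) (retract-punchIn b)
    (retract-reach (connected (punchIn v a) (punchIn v b)))

bipartition-delete : ∀ {N} {G : Graph (suc N)} {c} v → Bipartition G c → Bipartition (G -ᵛ v) (c ∘ punchIn v)
bipartition-delete {G = G} {c} v (bipartition simple proper) =
  bipartition (simple-delete {G = G} v simple) (proper-delete {G = G} {c} v proper)

bipartition-not : ∀ {N} {G : Graph N} {c} → Bipartition G c → Bipartition G (not ∘ c)
bipartition-not {G = G} (bipartition simple proper) = bipartition simple (proper-not {G = G} proper)

module Leaf {N} (G : Graph (suc N)) (c : Coloring (suc N)) (bip : Bipartition G c) (v : Fin (suc N))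
            (cv : c v ≡ true) (S : Single (G v)) where
  open Bipartition bip
  open Single S renaming (elem to w; elem∈ to vw)

  private
    p : Fin N → Fin (suc N)
    p = punchIn v
    G′ = G -ᵛ v
    c′ = c ∘ p
    χ : Fin N → ℤ
    χ u = ⟦ c′ u ⟧

  v-nonadjacent : ∀ u → c u ≡ true → G u v ≡ false
  v-nonadjacent u cu = same-color {G = G} proper (trans cu (sym cv))

  deg-v : deg G v ≡ + 1
  deg-v = trans (∑-cong λ u → sym (ℤ.*-identityʳ ⟦ G v u ⟧)) (∑-elem (λ _ → + 1))

  leaf-crossEdges : crossEdges G c ≡ + 1 + crossEdges G′ c′
  leaf-crossEdges = trans (∑-⟦⟧* c v (deg G) cv) (cong₂ _+_ deg-v (∑-cong same))
    where
    same : ∀ u → χ u * deg G (p u) ≡ χ u * deg G′ u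
    same u with c (p u) in cu
    ... | false = refl
    ... | true = cong (+ 1 *_) (trans (∑-remove v (λ z → ⟦ G (p u) z ⟧))
      (trans (cong (λ b → ⟦ b ⟧ + deg G′ u) (v-nonadjacent (p u) cu)) (ℤ.+-identityˡ (deg G′ u))))

  cw : c w ≡ false
  cw = trans (opposite {G = G} proper vw) (cong not cv)

  codeg-v : ∀ u → codeg G v u ≡ ⟦ G u w ⟧
  codeg-v u = ∑-elem (λ z → ⟦ G u z ⟧)

  codeg-delete : ∀ a b → c (p a) ≡ true → codeg G (p a) (p b) ≡ codeg G′ a b
  codeg-delete a b ca = trans (∑-remove v (λ z → ⟦ G (p a) z ⟧ * ⟦ G (p b) z ⟧))
    (trans (cong (λ x → ⟦ x ⟧ * ⟦ G (p b) v ⟧ + codeg G′ a b) (v-nonadjacent (p a) ca)) (ℤ.+-identityˡ (codeg G′ a b)))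

  deg-w : ∑ (λ b → χ b * ⟦ G (p b) w ⟧) ≡ deg G w - + 1
  deg-w = begin
    ∑ (λ b → χ b * ⟦ G (p b) w ⟧)   ≡⟨ ∑-cong nbr ⟩
    ∑ (λ b → ⟦ G w (p b) ⟧)         ≡⟨ lem (∑ (λ b → ⟦ G w (p b) ⟧)) ⟩
    + 1 + ∑ (λ b → ⟦ G w (p b) ⟧) - + 1
      ≡⟨ cong (λ x → x - + 1) (sym (size-remove (G w) v (trans (symmetric w v) vw))) ⟩
    deg G w - + 1 ∎
    where
    lem : ∀ x → x ≡ + 1 + x - + 1
    lem = solve-∀
    nbr : ∀ b → χ b * ⟦ G (p b) w ⟧ ≡ ⟦ G w (p b) ⟧
    nbr b rewrite symmetric (p b) w with c (p b) in cb
    ... | true = ℤ.*-identityˡ ⟦ G w (p b) ⟧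
    ... | false rewrite same-color {G = G} proper (trans cw (sym cb)) = refl

  -- The leaf shares a neighbour only with neighbours of `w`, and then exactly one. Ordered pairs
  -- containing `v` contribute 1 for (v,v) and deg w - 1 on each side.
  leaf-codegSum : codegSum G c ≡ + 2 * deg G w - + 1 + codegSum G′ c′
  leaf-codegSum = begin
    ∑ (λ a → ∑ λ b → ⟦ c a ⟧ * ⟦ c b ⟧ * κ a b)
      ≡⟨ (∑-cong λ a → trans (∑-cong λ b → ℤ.*-assoc ⟦ c a ⟧ ⟦ c b ⟧ (κ a b)) (∑-* ⟦ c a ⟧ (λ b → ⟦ c b ⟧ * κ a b))) ⟩
    ∑ (λ a → ⟦ c a ⟧ * ∑ (λ b → ⟦ c b ⟧ * κ a b))
      ≡⟨ ∑-⟦⟧* c v (λ a → ∑ (λ b → ⟦ c b ⟧ * κ a b)) cv ⟩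
    ∑ (λ b → ⟦ c b ⟧ * κ v b) + ∑ (λ a → χ a * ∑ (λ b → ⟦ c b ⟧ * κ (p a) b))
      ≡⟨ cong₂ _+_ (trans (∑-⟦⟧* c v (κ v) cv) (cong₂ _+_ κ-vv row))
           (trans (∑-cong λ a → cong (χ a *_) (∑-⟦⟧* c v (κ (p a)) cv)) (trans (∑-cong rest)
             (trans (∑-+ (λ a → χ a * ⟦ G (p a) w ⟧) (λ a → ∑ λ b → χ a * χ b * κ′ a b))
                 (cong (_+ codegSum G′ c′) deg-w)))) ⟩
    (+ 1 + (deg G w - + 1)) + (deg G w - + 1 + codegSum G′ c′)
      ≡⟨ lem (deg G w) (codegSum G′ c′) ⟩
    + 2 * deg G w - + 1 + codegSum G′ c′ ∎
    where
    κ : Fin (suc N) → Fin (suc N) → ℤ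
    κ a b = codeg G a b * codeg G a b
    κ′ : Fin N → Fin N → ℤ
    κ′ a b = codeg G′ a b * codeg G′ a b
    lem : ∀ d k → (+ 1 + (d - + 1)) + (d - + 1 + k) ≡ + 2 * d - + 1 + k
    lem = solve-∀
    κ-v : ∀ u → κ v u ≡ ⟦ G u w ⟧
    κ-v u = trans (cong (λ x → x * x) (codeg-v u)) (⟦⟧-idem (G u w))
    κ-vv : κ v v ≡ + 1
    κ-vv = trans (κ-v v) (cong ⟦_⟧ vw)
    κ-v′ : ∀ u → κ u v ≡ ⟦ G u w ⟧
    κ-v′ u = trans (cong (λ x → x * x) (∑-cong λ z → ℤ.*-comm ⟦ G u z ⟧ ⟦ G v z ⟧)) (κ-v u)
    row : ∑ (λ b → χ b * κ v (p b)) ≡ deg G w - + 1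
    row = trans (∑-cong λ b → cong (χ b *_) (κ-v (p b))) deg-w
    rest : ∀ a → χ a * (κ (p a) v + ∑ (λ b → χ b * κ (p a) (p b))) ≡ χ a * ⟦ G (p a) w ⟧ + ∑ (λ b → χ a * χ b * κ′ a b)
    rest a = begin
      χ a * (κ (p a) v + ∑ (λ b → χ b * κ (p a) (p b)))
        ≡⟨ ℤ.*-distribˡ-+ (χ a) (κ (p a) v) (∑ (λ b → χ b * κ (p a) (p b))) ⟩
      χ a * κ (p a) v + χ a * ∑ (λ b → χ b * κ (p a) (p b))
        ≡⟨ cong₂ _+_ (cong (χ a *_) (κ-v′ (p a)))
             (trans (sym (∑-* (χ a) (λ b → χ b * κ (p a) (p b)))) (∑-cong inner)) ⟩
      χ a * ⟦ G (p a) w ⟧ + ∑ (λ b → χ a * χ b * κ′ a b) ∎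
      where
      inner : ∀ b → χ a * (χ b * κ (p a) (p b)) ≡ χ a * χ b * κ′ a b
      inner b with c (p a) in ca
      ... | false = refl
      ... | true = trans (cong (λ x → + 1 * (χ b * (x * x))) (codeg-delete a b ca)) (sym (ℤ.*-assoc (+ 1) (χ b) (κ′ a b)))

  -- The row of `v` has its single 1 in column `w`, so the nonzero minors using this row correspond
  -- to the edges that avoid `w`. The proof obtains the count algebraically from the expansion.
  leaf-minorSum : minorSum G c ≡ minorSum G′ c′ + + 4 * (crossEdges G c - deg G w)
  leaf-minorSum = begin
    minorSum G c  ≡⟨ minorSum-expand G c proper ⟩
    + 2 * (crossEdges G c * crossEdges G c) - + 2 * codegSum G c
      ≡⟨ cong₂ (λ x y → + 2 * (x * x) - + 2 * y) leaf-crossEdges leaf-codegSum ⟩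
    + 2 * ((+ 1 + M′) * (+ 1 + M′)) - + 2 * (+ 2 * deg G w - + 1 + K′)
      ≡⟨ lem M′ K′ (deg G w) ⟩
    + 2 * (M′ * M′) - + 2 * K′ + + 4 * (+ 1 + M′ - deg G w)
      ≡⟨ cong₂ (λ x y → x + + 4 * (y - deg G w)) (sym (minorSum-expand G′ c′ (proper-delete {G = G} {c} v proper)))
          (sym leaf-crossEdges) ⟩
    minorSum G′ c′ + + 4 * (crossEdges G c - deg G w) ∎
    where
    M′ = crossEdges G′ c′
    K′ = codegSum G′ c′
    lem : ∀ m k d → + 2 * ((+ 1 + m) * (+ 1 + m)) - + 2 * (+ 2 * d - + 1 + k) ≡ + 2 * (m * m) - + 2 * k + + 4 *
        (+ 1 + m - d)
    lem = solve-∀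

deg≤size : ∀ {N} {G : Graph N} {c} → Proper G c → ∀ {u} → c u ≡ false → deg G u ≤ size c
deg≤size {G = G} {c} proper {u} cu = ∑-mono bound
  where
  bound : ∀ v → ⟦ G u v ⟧ ≤ ⟦ c v ⟧
  bound v with G u v in uv
  ... | false = ⟦⟧-nonneg (c v)
  ... | true rewrite opposite {G = G} {c} proper uv | cu = ℤ.≤-refl

-- The lower bound

opaque
  ≤-by : ∀ {i j} d → + 0 ≤ d → d ≡ j - i → i ≤ j
  ≤-by d 0≤d refl = ℤ.0≤i-j⇒j≤i 0≤d

  diff : ∀ {i j} → i ≤ j → + 0 ≤ j - i
  diff = ℤ.i≤j⇒0≤j-i

-- The claimed minimum (m - n + 2)(2n - 4 - m) for parts of sizes p and q.
target : ℤ → ℤ → ℤ → ℤ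
target p q m = (m - (p + q) + + 2) * (+ 2 * (p + q) - + 4 - m)

slack : ℤ → ℤ → ℤ → ℤ
slack p q m = + 2 * (p + q) - + 4 - m

target-comm : ∀ p q m → target q p m ≡ target p q m
target-comm p q m = cong (λ x → (m - x + + 2) * (+ 2 * x - + 4 - m)) (ℤ.+-comm q p)

2size≤crossEdges : ∀ {N} (G : Graph N) c → (∀ u → + 2 ≤ deg G u) → + 2 * size c ≤ crossEdges G c
2size≤crossEdges G c deg≥2 = subst (_≤ crossEdges G c) (∑-* (+ 2) (λ u → ⟦ c u ⟧)) (∑-mono bound)
  where
  bound : ∀ u → + 2 * ⟦ c u ⟧ ≤ ⟦ c u ⟧ * deg G u
  bound u with c u
  ... | false = +≤+ z≤n
  ... | true = subst (+ 2 ≤_) (sym (ℤ.*-identityˡ (deg G u))) (deg≥2 u)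

crossEdges-not : ∀ {N} (G : Graph N) c → Bipartition G c → crossEdges G (not ∘ c) ≡ crossEdges G c
crossEdges-not G c (bipartition simple proper) =
  trans (sym (edgeCount≡crossEdges G (not ∘ c) simple (proper-not {G = G} proper)))
      (edgeCount≡crossEdges G c simple proper)

-- Both sides equal 4 a₄, which does not refer to the colouring.
minorSum-not : ∀ {N} (G : Graph (4 ℕ.+ N)) c → Bipartition G c → minorSum G (not ∘ c) ≡ minorSum G c
minorSum-not {N} G c (bipartition simple proper) =
  trans (sym (minorSum≡4a₄ N G (not ∘ c) simple (proper-not {G = G} proper))) (minorSum≡4a₄ N G c simple proper)

size-notnot : ∀ {N} (c : Coloring N) → size (not ∘ not ∘ c) ≡ size c
size-notnot c = ∑-cong λ u → cong ⟦_⟧ (Bool.not-involutive (c u))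

module Bounds {N} (G : Graph N) (c : Coloring N) where
  M = crossEdges G c
  p = size c
  q = size (not ∘ c)
  goal = + 4 * target p q M

-- 8 (pq - m) = 4 t s + 2 ((m - 2p)(m - 2q) + s²)
noLeaf-bound : ∀ {N} (G : Graph N) c → Bipartition G c → (∀ u → + 2 ≤ deg G u) →
  let open Bounds G c in goal + + 2 * (slack p q M * slack p q M) ≤ minorSum G c
noLeaf-bound G c bip deg≥2 = ≤-by _
  (ℤ.+-mono-≤ (diff (minorSum-nonedges G c bip deg≥2))
    (*-nonneg {+ 2} (+≤+ z≤n) (*-nonneg (diff (2size≤crossEdges G c deg≥2))
      (diff (subst (+ 2 * q ≤_) (crossEdges-not G c bip) (2size≤crossEdges G (not ∘ c) deg≥2))))))
  (lem M p q (minorSum G c))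
  where
  open Bounds G c
  lem : ∀ m p q f → (f - + 8 * (p * q - m)) + + 2 * ((m - + 2 * p) * (m - + 2 * q)) ≡
    f - (+ 4 * ((m - (p + q) + + 2) * (+ 2 * (p + q) - + 4 - m))
         + + 2 * ((+ 2 * (p + q) - + 4 - m) * (+ 2 * (p + q) - + 4 - m)))
  lem = solve-∀

pair-bound : ∀ {N} (G : Graph N) c → Bipartition G c → (∀ u → ∃ λ w → G u w ≡ true) → size c ≡ + 2 →
  let open Bounds G c in goal ≤ minorSum G c
pair-bound G c bip nonisolated size≡ = ≤-by _
  (*-nonneg {+ 4} (+≤+ z≤n) (*-nonneg (diff (le fst∈)) (diff (le snd∈))))
  (trans (lem M q (q - deg G fst) (q - deg G snd)) (cong₂ (λ f p → f - + 4 * target p q M)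
    (sym (minorSum-pair G c bip nonisolated (size≡2 c size≡))) (sym size≡)))
  where
  open Bounds G c
  open Pair (size≡2 c size≡)
  le : ∀ {u} → c u ≡ true → deg G u ≤ q
  le cu = deg≤size {G = G} {not ∘ c} (proper-not {G = G} (Bipartition.proper bip)) (cong not cu)
  lem : ∀ m q x y → + 4 * (x * y) ≡ + 4 * ((m - q) * (+ 2 * q - m) + x * y) - + 4 *
      ((m - (+ 2 + q) + + 2) * (+ 2 * (+ 2 + q) - + 4 - m))
  lem = solve-∀

size-remove-not : ∀ {N} (c : Coloring (suc N)) v → c v ≡ true → size (not ∘ c ∘ punchIn v) ≡ size (not ∘ c)
size-remove-not c v cv = sym (trans (∑-remove v (λ u → ⟦ not (c u) ⟧))
  (trans (cong (λ b → ⟦ not b ⟧ + size (not ∘ c ∘ punchIn v)) cv) (ℤ.+-identityˡ (size (not ∘ c ∘ punchIn v)))))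

-- Deleting the leaf lowers p and m by 1, which fixes t = m - p - q + 2 and lowers s by 1, so the
-- target falls by t. The minor sum falls by 4 (m - deg w), and deg w ≤ p gives m - deg w ≥ t + (q -
-- 2).
leaf-bound : ∀ {N} (G : Graph (suc N)) c → Bipartition G c → ∀ v → c v ≡ true → deg G v ≡ + 1 →
  + 4 * target (size (c ∘ punchIn v)) (size (not ∘ c ∘ punchIn v)) (crossEdges (G -ᵛ v) (c ∘ punchIn v))
    ≤ minorSum (G -ᵛ v) (c ∘ punchIn v) →
  let open Bounds G c in goal + + 4 * (q - + 2) ≤ minorSum G c
leaf-bound {N} G c bip v cv deg-v IH = ≤-by _
  (ℤ.+-mono-≤ (diff IH) (*-nonneg {+ 4} (+≤+ z≤n) (diff (deg≤size {G = G} (Bipartition.proper bip) cw))))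
  (trans (cong₂ (λ q′ p → (F′ - + 4 * target p′ q′ M′) + + 4 * (p - deg G w)) q′≡q (size-remove c v cv))
  (trans (lem M′ p′ q (deg G w) F′)
  (trans (cong₂ (λ p m → F′ + + 4 * (m - deg G w) - (+ 4 * target p q m + + 4 * (q - + 2))) (sym (size-remove c v cv))
      (sym leaf-crossEdges))
    (cong (λ f → f - (+ 4 * target p q M + + 4 * (q - + 2))) (sym leaf-minorSum)))))
  where
  open Bounds G c
  open Leaf G c bip v cv (size≡1 (G v) deg-v) using (cw; leaf-crossEdges; leaf-minorSum)
  w = Single.elem (size≡1 (G v) deg-v)
  F′ = minorSum (G -ᵛ v) (c ∘ punchIn v)
  M′ = crossEdges (G -ᵛ v) (c ∘ punchIn v)
  p′ = size (c ∘ punchIn v)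
  q′≡q : size (not ∘ c ∘ punchIn v) ≡ q
  q′≡q = size-remove-not c v cv
  lem : ∀ m p q d f → (f - + 4 * ((m - (p + q) + + 2) * (+ 2 * (p + q) - + 4 - m))) + + 4 * (+ 1 + p - d) ≡
    f + + 4 * (+ 1 + m - d) - (+ 4 * ((+ 1 + m - (+ 1 + p + q) + + 2) * (+ 2 * (+ 1 + p + q) - + 4 - (+ 1 + m))) + +
        4 * (q - + 2))
  lem = solve-∀

strict-from : ∀ {g f x} → g + + 4 * (x - + 2) ≤ f → + 3 ≤ x → g + + 1 ≤ f
strict-from {g} {f} {x} le 3≤x = ≤-by _
  (ℤ.+-mono-≤ (diff le) (ℤ.+-mono-≤ (*-nonneg {+ 4} (+≤+ z≤n) (diff 3≤x)) (+≤+ (z≤n {3})))) (lem g f x)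
  where
  lem : ∀ g f x → (f - (g + + 4 * (x - + 2))) + (+ 4 * (x - + 3) + + 3) ≡ f - (g + + 1)
  lem = solve-∀

strict-square : ∀ {g f s} → g + + 2 * (s * s) ≤ f → + 1 ≤ s → g + + 1 ≤ f
strict-square {g} {f} {s} le 1≤s = ≤-by _
  (ℤ.+-mono-≤ (diff le) (ℤ.+-mono-≤ (ℤ.+-mono-≤ (*-nonneg {+ 2} (+≤+ z≤n) (*-nonneg (diff 1≤s) (diff 1≤s)))
    (*-nonneg {+ 4} (+≤+ z≤n) (diff 1≤s))) (+≤+ (z≤n {1})))) (lem g f s)
  where
  -- Here 2 s² - 1 is written in powers of s - 1 with nonnegative coefficients.
  lem : ∀ g f s → (f - (g + + 2 * (s * s))) + (+ 2 * ((s - + 1) * (s - + 1)) + + 4 * (s - + 1) + + 1) ≡ f - (g + + 1)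
  lem = solve-∀

weaken : ∀ {g f} → g + + 1 ≤ f → g ≤ f
weaken {g} le = ℤ.≤-trans (ℤ.i≤i+j g (+ 1)) le

2≤⇒≡2⊎3≤ : ∀ {i} → + 2 ≤ i → i ≡ + 2 ⊎ + 3 ≤ i
2≤⇒≡2⊎3≤ {i} 2≤i with i ℤ.≟ + 2
... | yes i≡2 = inj₁ i≡2
... | no i≢2 = inj₂ (ℤ.i<j⇒suc[i]≤j (ℤ.≤∧≢⇒< 2≤i (i≢2 ∘ sym)))

connected-nonisolated : ∀ {N} (G : Graph (2 ℕ.+ N)) → Connected G → ∀ u → ∃ λ w → G u w ≡ true
connected-nonisolated G connected zero = neighbour {G = G} connected {zero} {suc zero} λ ()
connected-nonisolated G connected (suc u) = neighbour {G = G} connected {suc u} {zero} λ ()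

-- The weak half has to cover slack ≤ 0 as well, because each leaf deletion lowers the slack by one.
-- A slack of at least 1 makes the term 2 s² of the leafless case positive.
Bound StrictBound : ∀ {N} → Graph N → Coloring N → Set
Bound G c = let open Bounds G c in + 4 * target p q M ≤ minorSum G c
StrictBound G c = let open Bounds G c in (+ 4 * target p q M ≤ minorSum G c) ×
    (+ 1 ≤ slack p q M → + 4 * target p q M + + 1 ≤ minorSum G c)

-- Lets a class of two vertices, or the class of a leaf, be taken as the one coloured `true`. The
-- addend `k` is 0 for the weak and 1 for the strict inequality.
unflip : ∀ {N} (G : Graph (4 ℕ.+ N)) c → Bipartition G c → ∀ k →
  let module B = Bounds G c; module B′ = Bounds G (not ∘ c) in
  B′.goal + k ≤ minorSum G (not ∘ c) → B.goal + k ≤ minorSum G c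
unflip G c bip k = subst₂ _≤_ (cong (λ x → + 4 * x + k) (trans
    (cong₂ (target q) (size-notnot c) (crossEdges-not G c bip)) (target-comm p q M))) (minorSum-not G c bip)
  where open Bounds G c

add-0 : ∀ {g f} → g ≤ f → g + + 0 ≤ f
add-0 {g} le = subst (_≤ _) (sym (ℤ.+-identityʳ g)) le

drop-0 : ∀ {g f} → g + + 0 ≤ f → g ≤ f
drop-0 {g} le = subst (_≤ _) (ℤ.+-identityʳ g) le

6≰4 : ¬ (+ 6 ≤ + 4)
6≰4 (+≤+ (s≤s (s≤s (s≤s (s≤s ())))))

-- The three statements form one induction on N: `leaf-case` calls `bound` on the graph without the
-- leaf, whose class may have shrunk to two vertices, and there the exact formula takes over.
bound : ∀ N (G : Graph (4 ℕ.+ N)) c → Bipartition G c → Connected G → + 2 ≤ size c → + 2 ≤ size (not ∘ c) → Bound G c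
strict-bound : ∀ N (G : Graph (4 ℕ.+ N)) c → Bipartition G c → Connected G → + 3 ≤ size c → + 3 ≤ size (not ∘ c) →
    StrictBound G c
leaf-case : ∀ N (G : Graph (4 ℕ.+ N)) c → Bipartition G c → Connected G → + 3 ≤ size c → + 3 ≤ size (not ∘ c) →
  ∀ v → c v ≡ true → deg G v ≡ + 1 → let open Bounds G c in goal + + 1 ≤ minorSum G c

bound N G c bip conn p≥2 q≥2 with 2≤⇒≡2⊎3≤ p≥2 | 2≤⇒≡2⊎3≤ q≥2
... | inj₁ p≡2 | _ = pair-bound G c bip (connected-nonisolated G conn) p≡2
... | inj₂ _ | inj₁ q≡2 = drop-0 {Bounds.goal G c} (unflip G c bip (+ 0)
    (add-0 {Bounds.goal G (not ∘ c)} (pair-bound G (not ∘ c) (bipartition-not bip) (connected-nonisolated G conn) q≡2)))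
... | inj₂ p≥3 | inj₂ q≥3 = proj₁ (strict-bound N G c bip conn p≥3 q≥3)

strict-bound N G c bip conn p≥3 q≥3 with Fin.any? (λ v → deg G v ℤ.≟ + 1)
... | yes (v , deg-v) = weaken {goal} strict , λ _ → strict
  where
  open Bounds G c
  strict : goal + + 1 ≤ minorSum G c
  strict with c v in cv
  ... | true = leaf-case N G c bip conn p≥3 q≥3 v cv deg-v
  ... | false = unflip G c bip (+ 1) (leaf-case N G (not ∘ c) (bipartition-not bip) conn q≥3
      (subst (+ 3 ≤_) (sym (size-notnot c)) p≥3) v (cong not cv) deg-v)
... | no no-leaf = ℤ.≤-trans (≤-by _ sq≥0 (lem goal (slack p q M))) base , strict-square {goal} {minorSum G c}
    {slack p q M} base
  where
  open Bounds G c
  lem : ∀ g s → + 2 * (s * s) ≡ g + + 2 * (s * s) - g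
  lem = solve-∀
  sq≥0 : + 0 ≤ + 2 * (slack p q M * slack p q M)
  sq≥0 = *-nonneg {+ 2} (+≤+ z≤n) (square-nonneg (slack p q M))
    where
    square-nonneg : ∀ i → + 0 ≤ i * i
    square-nonneg (+ n) = *-nonneg {+ n} {+ n} (+≤+ z≤n) (+≤+ z≤n)
    square-nonneg (ℤ.negsuc n) = +≤+ z≤n
  deg≥2 : ∀ u → + 2 ≤ deg G u
  deg≥2 u with connected-nonisolated G conn u
  ... | w , uw = ℤ.i<j⇒suc[i]≤j (ℤ.≤∧≢⇒< (size≥1 (G u) w uw) λ 1≡deg → no-leaf (u , sym 1≡deg))
  base : goal + + 2 * (slack p q M * slack p q M) ≤ minorSum G c
  base = noLeaf-bound G c bip deg≥2

-- Four vertices cannot form two classes of at least three each.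
leaf-case zero G c bip conn p≥3 q≥3 v cv deg-v = contradiction (subst (+ 6 ≤_) (size-not c) (ℤ.+-mono-≤ p≥3 q≥3)) 6≰4
leaf-case (suc N) G c bip conn p≥3 q≥3 v cv deg-v = strict-from {goal} {minorSum G c} {q}
  (leaf-bound G c bip v cv deg-v
    (bound N (G -ᵛ v) (c ∘ punchIn v) (bipartition-delete v bip) conn′ p′≥2
        (subst (+ 2 ≤_) (sym q′≡q) (ℤ.≤-trans (+≤+ (s≤s (s≤s z≤n))) q≥3))))
  q≥3
  where
  open Bounds G c
  open Single (size≡1 (G v) deg-v)
  v≢elem : v ≢ elem
  v≢elem v≡ = contradiction (trans (sym elem∈) (trans (cong (G v) (sym v≡)) (proj₂ (Bipartition.simple bip) v))) λ ()
  conn′ : Connected (G -ᵛ v)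
  conn′ = leaf-connected G (Bipartition.symmetric bip) v (punchOut v≢elem)
    (λ u vu → trans (unique u vu) (sym (Fin.punchIn-punchOut v≢elem))) conn
  p′≥2 : + 2 ≤ size (c ∘ punchIn v)
  p′≥2 = ≤-by _ (diff (subst (+ 3 ≤_) (size-remove c v cv) p≥3)) (lem (size (c ∘ punchIn v)))
    where
    lem : ∀ x → + 1 + x - + 3 ≡ x - + 2
    lem = solve-∀
  q′≡q : size (not ∘ c ∘ punchIn v) ≡ q
  q′≡q = size-remove-not c v cv

-- Uniqueness

Label : Set
Label = Bool × Bool

isLabel : Label → Label → Bool
isLabel (true , true) (x , y) = x ∧ y
isLabel (true , false) (x , y) = x ∧ not y
isLabel (false , true) (x , y) = not x ∧ y
isLabel (false , false) (x , y) = not x ∧ not y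

isLabel-refl : ∀ k → isLabel k k ≡ true
isLabel-refl (true , true) = refl
isLabel-refl (true , false) = refl
isLabel-refl (false , true) = refl
isLabel-refl (false , false) = refl

isLabel⇒≡ : ∀ k l → isLabel k l ≡ true → k ≡ l
isLabel⇒≡ (true , true) (true , true) _ = refl
isLabel⇒≡ (true , false) (true , false) _ = refl
isLabel⇒≡ (false , true) (false , true) _ = refl
isLabel⇒≡ (false , false) (false , false) _ = refl

-- Greedy: vertex `zero` is matched with any vertex of its label. Removing both keeps the label
-- counts equal, and the matching of the rest is extended by this pair.
label-matching : ∀ N N′ (l : Fin N → Label) (l′ : Fin N′ → Label) →
  (∀ k → size (isLabel k ∘ l) ≡ size (isLabel k ∘ l′)) →
  Σ (Fin N ↔ Fin N′) λ f → ∀ u → l u ≡ l′ (Inverse.to f u)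
label-matching zero zero l l′ same = Perm.id , λ ()
label-matching zero (suc N′) l l′ same = contradiction
  (subst (+ 1 ≤_) (trans (sym (same (l′ zero))) (∑-empty (λ u → ⟦ isLabel (l′ zero) (l u) ⟧)))
    (size≥1 (isLabel (l′ zero) ∘ l′) zero (isLabel-refl (l′ zero)))) λ { (+≤+ ()) }
label-matching (suc N) N′ l l′ same with size≢0 (isLabel (l zero) ∘ l′) nonempty
  where
  nonempty : size (isLabel (l zero) ∘ l′) ≢ + 0
  nonempty eq = contradiction (subst (+ 1 ≤_) (trans (same (l zero)) eq)
    (size≥1 (isLabel (l zero) ∘ l) zero (isLabel-refl (l zero)))) λ { (+≤+ ()) }
label-matching (suc N) (suc N′) l l′ same | u , eq
  with label-matching N N′ (l ∘ suc) (l′ ∘ punchIn u) rest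
  where
  same-rest : ∀ k → ⟦ isLabel k (l zero) ⟧ + size (isLabel k ∘ l ∘ suc) ≡
    ⟦ isLabel k (l zero) ⟧ + size (isLabel k ∘ l′ ∘ punchIn u)
  same-rest k = begin
    ⟦ isLabel k (l zero) ⟧ + size (isLabel k ∘ l ∘ suc)  ≡⟨ sym (∑-suc (λ v → ⟦ isLabel k (l v) ⟧)) ⟩
    size (isLabel k ∘ l)                                  ≡⟨ same k ⟩
    size (isLabel k ∘ l′)                                 ≡⟨ ∑-remove u (λ v → ⟦ isLabel k (l′ v) ⟧) ⟩
    ⟦ isLabel k (l′ u) ⟧ + size (isLabel k ∘ l′ ∘ punchIn u)
      ≡⟨ cong (λ x → ⟦ isLabel k x ⟧ + size (isLabel k ∘ l′ ∘ punchIn u)) (sym (isLabel⇒≡ (l zero) (l′ u) eq)) ⟩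
    ⟦ isLabel k (l zero) ⟧ + size (isLabel k ∘ l′ ∘ punchIn u) ∎
  cancel : ∀ x {y z} → x + y ≡ x + z → y ≡ z
  cancel x {y} {z} xy≡xz = trans (lem x y) (trans (cong (_- x) xy≡xz) (sym (lem x z)))
    where
    lem : ∀ x y → y ≡ x + y - x
    lem = solve-∀
  rest : ∀ k → size (isLabel k ∘ l ∘ suc) ≡ size (isLabel k ∘ l′ ∘ punchIn u)
  rest k = cancel ⟦ isLabel k (l zero) ⟧ (same-rest k)
... | π , matches = Perm.insert zero u π , matches′
  where
  matches′ : ∀ v → l v ≡ l′ (Inverse.to (Perm.insert zero u π) v)
  matches′ zero = isLabel⇒≡ (l zero) (l′ u) eq
  matches′ (suc v) = trans (matches v) (cong l′ (sym (Perm.insert-punchIn zero u π v)))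

swap-pair : ∀ {N} {c : Coloring N} → Pair c → Pair c
swap-pair P = record
  { fst = snd ; snd = fst ; fst∈ = snd∈ ; snd∈ = fst∈ ; fst≢snd = fst≢snd ∘ sym
  ; ∈-cases = λ u cu → Sum.swap (∈-cases u cu)
  ; ∑-pair = λ g → trans (∑-pair g) (ℤ.+-comm (g fst) (g snd)) }
  where open Pair P

size-∧-pair : ∀ {N} {c : Coloring N} (P : Pair c) (d : Coloring N) →
  size (λ u → c u ∧ d u) ≡ ⟦ d (Pair.fst P) ⟧ + ⟦ d (Pair.snd P) ⟧
size-∧-pair {c = c} P d = trans (∑-cong λ u → ∧-* (c u) (d u)) (Pair.∑-pair P (λ u → ⟦ d u ⟧))
  where
  ∧-* : ∀ x y → ⟦ x ∧ y ⟧ ≡ ⟦ x ⟧ * ⟦ y ⟧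
  ∧-* true y = sym (ℤ.*-identityˡ ⟦ y ⟧)
  ∧-* false y = refl

size-split : ∀ {N} (c d : Coloring N) → size (λ u → c u ∧ d u) + size (λ u → c u ∧ not (d u)) ≡ size c
size-split c d = trans (sym (∑-+ (λ u → ⟦ c u ∧ d u ⟧) (λ u → ⟦ c u ∧ not (d u) ⟧))) (∑-cong λ u → cases (c u) (d u))
  where
  cases : ∀ x y → ⟦ x ∧ y ⟧ + ⟦ x ∧ not y ⟧ ≡ ⟦ x ⟧
  cases true true = refl
  cases true false = refl
  cases false y = refl

record Dominated {N} (G : Graph N) (c : Coloring N) : Set where
  field
    bip : Bipartition G c
    pair : Pair c
    full : deg G (Pair.fst pair) ≡ size (not ∘ c)

module Labelling {N} {G : Graph N} {c} (D : Dominated G c) where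
  open Dominated D
  open Bipartition bip
  open Pair pair renaming (fst to a; snd to b; fst∈ to ca; snd∈ to cb)

  -- In the pair the mark singles out the full vertex `a`, in the other class the neighbours of `b`.
  -- Vertices of different classes are then adjacent exactly when one of them is marked.
  mark : Coloring N
  mark u = if c u then does (u Fin.≟ a) else G b u

  label : Fin N → Label
  label u = c u , mark u

  ∧-neighbour : ∀ {u} → c u ≡ true → ∀ v → not (c v) ∧ G u v ≡ G u v
  ∧-neighbour {u} cu v with c v in cv
  ... | true = sym (same-color {G = G} proper (trans cu (sym cv)))
  ... | false = refl

  -- The nonneighbours of `a` in the other class number q - deg a = 0.
  a-full : ∀ v → c v ≡ false → G a v ≡ true
  a-full v cv with G a v | size≡0 (λ u → not (c u) ∧ not (G a u)) missing v
    where
    missing : size (λ u → not (c u) ∧ not (G a u)) ≡ + 0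
    missing = begin
      size (λ u → not (c u) ∧ not (G a u))
        ≡⟨ lem (deg G a) (size (λ u → not (c u) ∧ not (G a u))) ⟩
      deg G a + size (λ u → not (c u) ∧ not (G a u)) - deg G a
        ≡⟨ cong₂ _-_ (trans (cong (_+ size (λ u → not (c u) ∧ not (G a u)))
            (∑-cong λ u → cong ⟦_⟧ (sym (∧-neighbour ca u))))
             (size-split (not ∘ c) (G a))) full ⟩
      size (not ∘ c) - size (not ∘ c)
        ≡⟨ ℤ.+-inverseʳ (size (not ∘ c)) ⟩
      + 0 ∎
      where
      lem : ∀ x y → y ≡ x + y - x
      lem = solve-∀
  ... | true | _ = refl
  ... | false | eq rewrite cv = contradiction eq λ ()

  adjacency : ∀ u v → G u v ≡ (c u xor c v) ∧ (mark u ∨ mark v)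
  adjacency u v with c u in cu | c v in cv
  ... | true | true = same-color {G = G} proper (trans cu (sym cv))
  ... | false | false = same-color {G = G} proper (trans cu (sym cv))
  ... | true | false = across u v cu cv
    where
    across : ∀ u v → c u ≡ true → c v ≡ false → G u v ≡ does (u Fin.≟ a) ∨ G b v
    across u v cu cv with u Fin.≟ a
    ... | yes refl = a-full v cv
    ... | no u≢a with ∈-cases u cu
    ... | inj₁ u≡a = contradiction u≡a u≢a
    ... | inj₂ refl = refl
  ... | false | true with v Fin.≟ a
  ... | yes refl = trans (symmetric u v) (trans (a-full u cu) (sym (Bool.∨-zeroʳ (G b u))))
  ... | no v≢a with ∈-cases v cv
  ... | inj₁ v≡a = contradiction v≡a v≢a
  ... | inj₂ refl = trans (symmetric u v) (sym (Bool.∨-identityʳ (G b u)))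

  mark-a : mark a ≡ true
  mark-a rewrite ca = dec-true (a Fin.≟ a) refl

  mark-b : mark b ≡ false
  mark-b rewrite cb = dec-false (b Fin.≟ a) (fst≢snd ∘ sym)

  size-true-true : size (isLabel (true , true) ∘ label) ≡ + 1
  size-true-true = trans (size-∧-pair pair mark) (cong₂ (λ x y → ⟦ x ⟧ + ⟦ y ⟧) mark-a mark-b)

  size-true-false : size (isLabel (true , false) ∘ label) ≡ + 1
  size-true-false = trans (size-∧-pair pair (not ∘ mark)) (cong₂ (λ x y → ⟦ not x ⟧ + ⟦ not y ⟧) mark-a mark-b)

  size-false-true : size (isLabel (false , true) ∘ label) ≡ crossEdges G c - size (not ∘ c)
  size-false-true = begin
    size (λ u → not (c u) ∧ mark u)  ≡⟨ ∑-cong (λ u → cong ⟦_⟧ (marked u)) ⟩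
    deg G b                          ≡⟨ lem (deg G a) (deg G b) ⟩
    deg G a + deg G b - deg G a      ≡⟨ cong₂ _-_ (sym (pair-crossEdges G pair)) full ⟩
    crossEdges G c - size (not ∘ c) ∎
    where
    lem : ∀ x y → y ≡ x + y - x
    lem = solve-∀
    marked : ∀ u → not (c u) ∧ mark u ≡ G b u
    marked u = trans (unmark (c u) (does (u Fin.≟ a)) (G b u)) (∧-neighbour cb u)
      where
      unmark : ∀ x y z → not x ∧ (if x then y else z) ≡ not x ∧ z
      unmark true y z = refl
      unmark false y z = refl

  size-false-false : size (isLabel (false , false) ∘ label) ≡ size (not ∘ c) - (crossEdges G c - size (not ∘ c))
  size-false-false = begin
    x                                              ≡⟨ lem y x ⟩
    y + x - y                                      ≡⟨ cong₂ _-_ (size-split (not ∘ c) mark) size-false-true ⟩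
    size (not ∘ c) - (crossEdges G c - size (not ∘ c)) ∎
    where
    x = size (isLabel (false , false) ∘ label)
    y = size (isLabel (false , true) ∘ label)
    lem : ∀ x y → y ≡ x + y - x
    lem = solve-∀

-- The four labels occur 1, 1, M - q and q - (M - q) times, which depends on q and M only; a
-- label-preserving bijection preserves adjacency since labels determine it.
dominated-iso : ∀ {N N′} {G : Graph N} {H : Graph N′} {c d} → Dominated G c → Dominated H d →
  size (not ∘ c) ≡ size (not ∘ d) → crossEdges G c ≡ crossEdges H d → Iso G H
dominated-iso {G = G} {H} {c} {d} domG domH q≡ M≡ = f , λ u v → trans (LG.adjacency u v)
  (trans (cong₂ (λ x y → (proj₁ x xor proj₁ y) ∧ (proj₂ x ∨ proj₂ y)) (matches u) (matches v))
    (sym (LH.adjacency (Inverse.to f u) (Inverse.to f v))))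
  where
  module LG = Labelling domG
  module LH = Labelling domH
  same : ∀ k → size (isLabel k ∘ LG.label) ≡ size (isLabel k ∘ LH.label)
  same (true , true) = trans LG.size-true-true (sym LH.size-true-true)
  same (true , false) = trans LG.size-true-false (sym LH.size-true-false)
  same (false , true) = trans LG.size-false-true (trans (cong₂ _-_ M≡ q≡) (sym LH.size-false-true))
  same (false , false) = trans LG.size-false-false (trans (cong₂ (λ M q → q - (M - q)) M≡ q≡) (sym LH.size-false-false))
  matching = label-matching _ _ LG.label LH.label same
  f = proj₁ matching
  matches = proj₂ matching

-- The difference graph

xyAdj-irrefl : ∀ a → xyAdj 2 a a ≡ false
xyAdj-irrefl 0 = refl
xyAdj-irrefl 1 = refl
xyAdj-irrefl (suc (suc a)) = refl

xyAdj-proper : ∀ a b → xyAdj 2 a b ≡ true → (a <ᵇ 2) ≢ (b <ᵇ 2)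
xyAdj-proper 0 (suc (suc b)) _ ()
xyAdj-proper 1 (suc (suc b)) _ ()

module DiffGraph (k s : ℕ) where

  t Ny : ℕ
  t = 2 ℕ.+ k
  -- The form `s + 0` is what the `sum` of the block sizes reduces to, so that `D` typechecks
  -- without a cast. Writing t as 2 + k builds in m ≥ n and exhibits at least four vertices.
  Ny = t ℕ.+ (s ℕ.+ 0)

  D : Graph (2 ℕ.+ Ny)
  D = diffGraph 2 (1 ∷ 1 ∷ []) (t ∷ s ∷ [])

  block : Fin (2 ℕ.+ Ny) → ℕ
  block u = blockOf (1 ∷ˡ 1 ∷ˡ t ∷ˡ s ∷ˡ []ˡ) (toℕ u)

  c : Coloring (2 ℕ.+ Ny)
  c u = block u <ᵇ 2

  y : Fin Ny → Fin (2 ℕ.+ Ny)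
  y v = suc (suc v)

  bip : Bipartition D c
  bip = bipartition
    ((λ u v → Bool.∨-comm (xyAdj 2 (block u) (block v)) (xyAdj 2 (block v) (block u)))
      , λ u → cong₂ _∨_ (xyAdj-irrefl (block u)) (xyAdj-irrefl (block u)))
    proper
    where
    proper : Proper D c
    proper u v uv with xyAdj 2 (block u) (block v) in eq
    ... | true = xyAdj-proper (block u) (block v) eq
    ... | false = xyAdj-proper (block v) (block u) uv ∘ sym

  -- The bound on the position matters for vertex `zero`: in the last block the index is 3 and 0 + 3
  -- < 4, while a position past that block would get index 4 and be nonadjacent.
  blockOf-last : ∀ {z} → z ℕ.< s → blockOf (s ∷ˡ []ˡ) z ≡ 0
  blockOf-last {z} z<s with z <ᵇ s | ℕ.<⇒<ᵇ z<s
  ... | true | _ = refl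

  y-offset : ∀ (v : Fin Ny) → (toℕ v <ᵇ t) ≡ false → toℕ v ℕ.∸ t ℕ.< s
  y-offset v v≮t = subst (toℕ v ℕ.∸ t ℕ.<_) (trans (ℕ.m+n∸m≡n t (s ℕ.+ 0)) (ℕ.+-identityʳ s))
    (ℕ.∸-monoˡ-< {toℕ v} {t} {Ny} (Fin.toℕ<n v) (ℕ.≮⇒≥ λ v<t → subst T v≮t (ℕ.<⇒<ᵇ v<t)))

  D-0y : ∀ v → D zero (y v) ≡ true
  D-0y v with toℕ v <ᵇ t in eq
  ... | true = refl
  ... | false rewrite blockOf-last (y-offset v eq) = refl

  D-1y : ∀ v → D (suc zero) (y v) ≡ (toℕ v <ᵇ t)
  D-1y v with toℕ v <ᵇ t
  ... | true = refl
  -- The block index is at least 3 here, and 1 + 3 is not below 4.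
  ... | false = refl

  size-init : ∀ m n → size {m ℕ.+ n} (λ v → toℕ v <ᵇ m) ≡ + m
  size-init zero n = ∑-0 λ _ → refl
  size-init (suc m) n = trans (∑-suc {m ℕ.+ n} (λ v → ⟦ toℕ v <ᵇ suc m ⟧))
    (trans (cong (_+_ (+ 1)) (size-init m n)) (sym (ℤ.pos-+ 1 m)))

  ∑-split : ∀ (f : Fin (2 ℕ.+ Ny) → ℤ) → ∑ f ≡ f zero + (f (suc zero) + ∑ (f ∘ y))
  ∑-split f = trans (∑-suc f) (cong (_+_ (f zero)) (∑-suc (f ∘ suc)))

  size-c : size c ≡ + 2
  size-c = trans (∑-split (λ u → ⟦ c u ⟧)) (cong (λ x → + 1 + (+ 1 + x)) (∑-0 {f = λ v → ⟦ c (y v) ⟧} λ v → refl))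

  size-not-c : size (not ∘ c) ≡ + Ny
  size-not-c = trans (∑-split (λ u → ⟦ not (c u) ⟧))
    (trans (cong (λ x → + 0 + (+ 0 + x)) (∑-1 Ny)) refl)

  deg-0 : deg D zero ≡ + Ny
  deg-0 = trans (∑-split (λ u → ⟦ D zero u ⟧))
    (trans (cong (λ x → + 0 + (+ 0 + x)) (trans (∑-cong λ v → cong ⟦_⟧ (D-0y v)) (∑-1 Ny))) refl)

  deg-1 : deg D (suc zero) ≡ + t
  deg-1 = trans (∑-split (λ u → ⟦ D (suc zero) u ⟧))
    (trans (cong (λ x → + 0 + (+ 0 + x)) (trans (∑-cong λ v → cong ⟦_⟧ (D-1y v)) (size-init t (s ℕ.+ 0)))) refl)

  crossEdges-D : crossEdges D c ≡ + (Ny ℕ.+ t)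
  crossEdges-D = begin
    crossEdges D c  ≡⟨ ∑-split (λ u → ⟦ c u ⟧ * deg D u) ⟩
    + 1 * deg D zero + (+ 1 * deg D (suc zero) + ∑ (λ v → ⟦ c (y v) ⟧ * deg D (y v)))
      ≡⟨ cong₂ _+_ (trans (ℤ.*-identityˡ (deg D zero)) deg-0)
           (trans (cong₂ _+_ (trans (ℤ.*-identityˡ (deg D (suc zero))) deg-1)
               (∑-0 {f = λ v → ⟦ c (y v) ⟧ * deg D (y v)} λ v → refl))
             (ℤ.+-identityʳ (+ t))) ⟩
    + Ny + + t  ≡⟨ sym (ℤ.pos-+ Ny t) ⟩
    + (Ny ℕ.+ t) ∎

  edgeCount-D : edgeCount D ≡ Ny ℕ.+ t
  edgeCount-D = ℤ.+-injective (trans (edgeCount≡crossEdges D c (Bipartition.simple bip)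
      (Bipartition.proper bip)) crossEdges-D)

  reach-trans : ∀ {u v w} → Reach D u v → Reach D v w → Reach D u w
  reach-trans here vw = vw
  reach-trans (step e uv) vw = step e (reach-trans uv vw)

  sym-D : ∀ u v → D u v ≡ D v u
  sym-D = Bipartition.symmetric bip

  to-0 : ∀ u → Reach D u zero
  to-0 zero = here
  to-0 (suc zero) = step {w = y zero} (D-1y zero) (step (trans (sym-D (y zero) zero) (D-0y zero)) here)
  to-0 (suc (suc v)) = step (trans (sym-D (y v) zero) (D-0y v)) here

  from-0 : ∀ u → Reach D zero u
  from-0 zero = here
  from-0 (suc zero) = step {w = y zero} (D-0y zero) (step (trans (sym-D (y zero) (suc zero)) (D-1y zero)) here)
  from-0 (suc (suc v)) = step (D-0y v) here

  connected : Connected D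
  connected u v = reach-trans (to-0 u) (from-0 v)

  dominated : Dominated D c
  -- `size≡2` does not reveal which of its two vertices is the full vertex `zero`.
  dominated with Pair.∈-cases (size≡2 c size-c) zero refl
  ... | inj₁ eq = record { bip = bip ; pair = size≡2 c size-c ; full = trans (cong (deg D) (sym eq))
      (trans deg-0 (sym size-not-c)) }
  ... | inj₂ eq = record { bip = bip ; pair = swap-pair (size≡2 c size-c) ; full = trans (cong (deg D) (sym eq))
      (trans deg-0 (sym size-not-c)) }

-- The equality case and the theorem

dominated-minorSum : ∀ {N} {G : Graph N} {c} → Dominated G c → (∀ u → ∃ λ w → G u w ≡ true) →
  let M = crossEdges G c; q = size (not ∘ c) in minorSum G c ≡ + 4 * ((M - q) * (+ 2 * q - M))
dominated-minorSum {G = G} {c} dom nonisolated = trans (minorSum-pair G c bip nonisolated pair)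
  (trans (cong (λ x → + 4 * ((M - q) * (+ 2 * q - M) + (q - x) * (q - deg G (Pair.snd pair)))) full)
    (lem M q (deg G (Pair.snd pair))))
  where
  open Dominated dom
  M = crossEdges G c
  q = size (not ∘ c)
  lem : ∀ m q x → + 4 * ((m - q) * (+ 2 * q - m) + (q - q) * (q - x)) ≡ + 4 * ((m - q) * (+ 2 * q - m))
  lem = solve-∀

-- The excess over the minimum is 4 (q - deg a)(q - deg b) with both factors nonnegative. If it is
-- at most zero, one factor vanishes.
pair-of-full : ∀ {N} {G : Graph N} {c} → Bipartition G c → (∀ u → ∃ λ w → G u w ≡ true) → size c ≡ + 2 →
  minorSum G c ≤ + 4 * ((crossEdges G c - size (not ∘ c)) * (+ 2 * size (not ∘ c) - crossEdges G c)) → Dominated G c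
pair-of-full {G = G} {c} bip nonisolated size≡ upper = Sum.[ first , second ]′ (ℤ.i*j≡0⇒i≡0∨j≡0 x xy≡0)
  where
  P = size≡2 c size≡
  M = crossEdges G c
  q = size (not ∘ c)
  x = q - deg G (Pair.fst P)
  y = q - deg G (Pair.snd P)
  0≤ : ∀ {u} → c u ≡ true → + 0 ≤ q - deg G u
  0≤ cu = diff (deg≤size {G = G} {not ∘ c} (proper-not {G = G} (Bipartition.proper bip)) (cong not cu))
  xy≤0 : + 4 * (x * y) ≤ + 4 * + 0
  xy≤0 = subst (_≤ + 0) (trans (cong (λ z → z - + 4 * ((M - q) * (+ 2 * q - M)))
      (minorSum-pair G c bip nonisolated P)) (lem ((M - q) * (+ 2 * q - M)) (x * y)))
    (ℤ.i≤j⇒i-j≤0 upper)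
    where
    lem : ∀ a b → + 4 * (a + b) - + 4 * a ≡ + 4 * b
    lem = solve-∀
  xy≡0 : x * y ≡ + 0
  xy≡0 = ℤ.≤-antisym (ℤ.*-cancelˡ-≤-pos (x * y) (+ 0) (+ 4) xy≤0) (*-nonneg (0≤ (Pair.fst∈ P)) (0≤ (Pair.snd∈ P)))
  first : x ≡ + 0 → Dominated G c
  first x≡0 = record { bip = bip ; pair = P ; full = sym (ℤ.i-j≡0⇒i≡j q (deg G (Pair.fst P)) x≡0) }
  second : y ≡ + 0 → Dominated G c
  second y≡0 = record { bip = bip ; pair = swap-pair P ; full = sym (ℤ.i-j≡0⇒i≡j q (deg G (Pair.snd P)) y≡0) }

crossEdges≤ : ∀ {N} (G : Graph N) c → Bipartition G c → crossEdges G c ≤ size c * size (not ∘ c)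
crossEdges≤ G c bip = subst (crossEdges G c ≤_) (trans (∑-* q (λ u → ⟦ c u ⟧)) (ℤ.*-comm q (size c))) (∑-mono bound′)
  where
  q = size (not ∘ c)
  bound′ : ∀ u → ⟦ c u ⟧ * deg G u ≤ q * ⟦ c u ⟧
  bound′ u with c u in cu
  ... | false = ℤ.≤-reflexive (sym (ℤ.*-zeroʳ q))
  ... | true = subst₂ _≤_ (sym (ℤ.*-identityˡ (deg G u))) (sym (ℤ.*-identityʳ q))
    (deg≤size {G = G} {not ∘ c} (proper-not {G = G} (Bipartition.proper bip)) (cong not cu))

-- Since n ≤ m ≤ p q, the case p = 0 is impossible, and p = 1 would give n ≤ q = n - 1.
2≤size : ∀ {N} (G : Graph (suc N)) c → Bipartition G c → + suc N ≤ crossEdges G c → + 2 ≤ size c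
2≤size {N} G c bip N≤M = cases (size c) refl (size-nonneg c)
  where
  q = size (not ∘ c)
  N≤pq : ∀ {p} → size c ≡ p → + suc N ≤ p * q
  N≤pq refl = ℤ.≤-trans N≤M (crossEdges≤ G c bip)
  cases : ∀ p → size c ≡ p → + 0 ≤ p → + 2 ≤ p
  cases (+ suc (suc n)) _ _ = +≤+ (s≤s (s≤s z≤n))
  cases (+ 0) p≡ _ = contradiction (N≤pq p≡) λ { (+≤+ ()) }
  cases (+ 1) p≡ _ = contradiction (subst (+ 1 ≤_) (ℤ.+-inverseʳ q) (≤-by _ (diff 1+q≤q) (lem q))) λ { (+≤+ ()) }
    where
    1+q≤q : + 1 + q ≤ q
    1+q≤q = subst₂ _≤_ (trans (sym (size-not c)) (cong (_+ q) p≡)) (ℤ.*-identityˡ q) (N≤pq p≡)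
    lem : ∀ q → q - (+ 1 + q) ≡ q - q - + 1
    lem = solve-∀

module Optimality (k s : ℕ) (1≤s : 1 ℕ.≤ s) where
  open DiffGraph k s

  n m : ℕ
  n = 2 ℕ.+ Ny
  m = Ny ℕ.+ t

  least : ℤ
  -- This is t s, in the shape that the formula for a class of two vertices gives with q = `Ny`.
  least = (+ m - + Ny) * (+ 2 * + Ny - + m)

  acoef-D : + 4 * acoef 4 D ≡ + 4 * least
  acoef-D = begin
    + 4 * acoef 4 D
      ≡⟨ minorSum≡4a₄ (k ℕ.+ (s ℕ.+ 0)) D c (Bipartition.simple bip) (Bipartition.proper bip) ⟩
    minorSum D c
      ≡⟨ dominated-minorSum dominated (connected-nonisolated D connected) ⟩
    + 4 * ((crossEdges D c - size (not ∘ c)) * (+ 2 * size (not ∘ c) - crossEdges D c))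
      ≡⟨ cong₂ (λ M q → + 4 * ((M - q) * (+ 2 * q - M))) crossEdges-D size-not-c ⟩
    + 4 * least ∎

  inB-D : InB n m D
  inB-D = refl , Bipartition.simple bip , connected , (c , Bipartition.proper bip) , edgeCount-D

  module _ (H : Graph n) (conn : Connected H) (edges : edgeCount H ≡ m) where

    crossEdges-H : ∀ {d} → Bipartition H d → crossEdges H d ≡ + m
    crossEdges-H {d} (bipartition simple proper) =
      trans (sym (edgeCount≡crossEdges H d simple proper)) (cong +_ edges)

    2≤size-H : ∀ d → Bipartition H d → + 2 ≤ size d
    2≤size-H d b = 2≤size H d b (subst (+ n ≤_) (sym (crossEdges-H b)) (+≤+ n≤m))
      where
      n≤m : n ℕ.≤ m
      n≤m = subst (ℕ._≤ m) (ℕ.+-comm Ny 2) (ℕ.+-monoʳ-≤ Ny (s≤s (s≤s z≤n)))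

    sizes : ∀ d → size d + size (not ∘ d) ≡ + 2 + + Ny
    sizes d = trans (size-not d) (ℤ.pos-+ 2 Ny)

    target-H : ∀ {d} → Bipartition H d → target (size d) (size (not ∘ d)) (crossEdges H d) ≡ least
    target-H {d} b = trans (cong₂ (λ x M → (M - x + + 2) * (+ 2 * x - + 4 - M)) (sizes d) (crossEdges-H b))
        (lem (+ m) (+ Ny))
      where
      lem : ∀ m q → (m - (+ 2 + q) + + 2) * (+ 2 * (+ 2 + q) - + 4 - m) ≡ (m - q) * (+ 2 * q - m)
      lem = solve-∀

    1≤slack : ∀ {d} → Bipartition H d → + 1 ≤ slack (size d) (size (not ∘ d)) (crossEdges H d)
    1≤slack {d} b = subst (+ 1 ≤_) (sym eq) (+≤+ 1≤s)
      where
      lem : ∀ t s → + 2 * (+ 2 + (t + s)) - + 4 - (t + s + t) ≡ s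
      lem = solve-∀
      Ny≡ : + Ny ≡ + t + + s
      Ny≡ = trans (ℤ.pos-+ t (s ℕ.+ 0)) (cong (λ x → + t + + x) (ℕ.+-identityʳ s))
      eq : slack (size d) (size (not ∘ d)) (crossEdges H d) ≡ + s
      eq = trans (cong₂ (λ x M → + 2 * x - + 4 - M)
             (trans (sizes d) (cong (_+_ (+ 2)) Ny≡))
             (trans (crossEdges-H b) (trans (ℤ.pos-+ Ny t) (cong (_+ + t) Ny≡))))
           (lem (+ t) (+ s))

    least≤minorSum : ∀ d → Bipartition H d → + 4 * least ≤ minorSum H d
    least≤minorSum d b = subst (λ x → + 4 * x ≤ minorSum H d) (target-H b)
      (bound (k ℕ.+ (s ℕ.+ 0)) H d b conn (2≤size-H d b) (2≤size-H (not ∘ d) (bipartition-not b)))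

    pair-iso : ∀ d → Bipartition H d → size d ≡ + 2 → minorSum H d ≤ + 4 * least → Iso H D
    pair-iso d b size≡ upper = dominated-iso
      (pair-of-full b (connected-nonisolated H conn) size≡
        (subst (minorSum H d ≤_) (cong₂ (λ M q → + 4 * ((M - q) * (+ 2 * q - M))) (sym (crossEdges-H b)) (sym q≡)) upper))
      dominated (trans q≡ (sym size-not-c)) (trans (crossEdges-H b) (sym crossEdges-D))
      where
      lem : ∀ x → x ≡ + 2 + x - + 2
      lem = solve-∀
      q≡ : size (not ∘ d) ≡ + Ny
      q≡ = begin
        size (not ∘ d)                ≡⟨ lem (size (not ∘ d)) ⟩
        + 2 + size (not ∘ d) - + 2    ≡⟨ cong (λ x → x + size (not ∘ d) - + 2) (sym size≡) ⟩
        size d + size (not ∘ d) - + 2 ≡⟨ cong (_- + 2) (sizes d) ⟩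
        + 2 + + Ny - + 2              ≡⟨ sym (lem (+ Ny)) ⟩
        + Ny ∎

    minimal-iso : ∀ d → Bipartition H d → minorSum H d ≤ + 4 * least → Iso H D
    minimal-iso d b upper = cases (2≤⇒≡2⊎3≤ (2≤size-H d b)) (2≤⇒≡2⊎3≤ (2≤size-H (not ∘ d) (bipartition-not b)))
      where
      cases : size d ≡ + 2 ⊎ + 3 ≤ size d → size (not ∘ d) ≡ + 2 ⊎ + 3 ≤ size (not ∘ d) → Iso H D
      cases (inj₁ p≡2) _ = pair-iso d b p≡2 upper
      cases (inj₂ _) (inj₁ q≡2) = pair-iso (not ∘ d) (bipartition-not b) q≡2
        (subst (_≤ + 4 * least) (sym (minorSum-not H d b)) upper)
      cases (inj₂ p≥3) (inj₂ q≥3) = contradiction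
        (subst (λ x → + 4 * x + + 1 ≤ minorSum H d) (target-H b)
          (proj₂ (strict-bound (k ℕ.+ (s ℕ.+ 0)) H d b conn p≥3 q≥3) (1≤slack b)))
        λ strict → ℤ.<-irrefl refl (ℤ.<-≤-trans (ℤ.suc[i]≤j⇒i<j
            (subst (_≤ minorSum H d) (ℤ.+-comm (+ 4 * least) (+ 1)) strict)) upper)

  optimal : BipartiteOptimal n m D
  optimal = inB-D , minimal
    where
    minimal : ∀ {N} (H : Graph N) → InB n m H → acoef 4 D ≤ acoef 4 H
    minimal H (refl , simple , conn , (d , proper) , edges) = ℤ.*-cancelˡ-≤-pos (acoef 4 D) (acoef 4 H) (+ 4)
      (subst₂ _≤_ (sym acoef-D) (sym (minorSum≡4a₄ (k ℕ.+ (s ℕ.+ 0)) H d simple proper))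
        (least≤minorSum H conn edges d (bipartition simple proper)))

  unique : ∀ {N} (H : Graph N) → BipartiteOptimal n m H → Iso H D
  unique H ((refl , simple , conn , (d , proper) , edges) , minimal) =
    minimal-iso H conn edges d (bipartition simple proper)
      (subst₂ _≤_ (minorSum≡4a₄ (k ℕ.+ (s ℕ.+ 0)) H d simple proper) acoef-D
        (ℤ.*-monoˡ-≤-nonNeg (+ 4) (minimal D inB-D)))

UniqueOptimum : (n m t s : ℕ) → Set
UniqueOptimum n m t s =
  BipartiteOptimal n m (diffGraph 2 (1 ∷ 1 ∷ []) (t ∷ s ∷ []))
  × (∀ {N} (H : Graph N) → BipartiteOptimal n m H → Iso H (diffGraph 2 (1 ∷ 1 ∷ []) (t ∷ s ∷ [])))

theorem5p2 : (n m : ℕ) → 6 ℕ.≤ n → n ℕ.∸ 1 ℕ.< m → m ℕ.< 2 ℕ.* (n ℕ.∸ 2) →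
    BipartiteOptimal n m (diffGraph 2 (1 ∷ 1 ∷ []) ((m ℕ.∸ n ℕ.+ 2) ∷ (2 ℕ.* n ℕ.∸ 4 ℕ.∸ m) ∷ []))
    × (∀ {N} (H : Graph N) → BipartiteOptimal n m H →
    Iso H (diffGraph 2 (1 ∷ 1 ∷ []) ((m ℕ.∸ n ℕ.+ 2) ∷ (2 ℕ.* n ℕ.∸ 4 ℕ.∸ m) ∷ [])))
theorem5p2 (suc (suc r)) m 6≤n n∸1<m m<2r = transport (cong (2 ℕ.+_) r≡) m≡ (ℕ.+-comm 2 k)
  (Optimality.optimal k s 1≤s , Optimality.unique k s 1≤s)
  where
  k s : ℕ
  k = m ℕ.∸ (2 ℕ.+ r)
  s = 2 ℕ.* (2 ℕ.+ r) ℕ.∸ 4 ℕ.∸ m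
  -- The result for `k` and `s` has n and m as expressions in them; it is carried to the given n and
  -- m. The entry `s` already agrees with the one in the statement.
  transport : ∀ {n n′ m m′ t t′} → n ≡ n′ → m ≡ m′ → t ≡ t′ → UniqueOptimum n m t s → UniqueOptimum n′ m′ t′ s
  transport refl refl refl result = result
  twice : 2 ℕ.* (2 ℕ.+ r) ℕ.∸ 4 ≡ 2 ℕ.* r
  twice = sym (ℕ.*-distribˡ-∸ 2 (2 ℕ.+ r) 2)
  1≤s : 1 ℕ.≤ s
  1≤s = ℕ.m<n⇒0<n∸m (subst (m ℕ.<_) (sym twice) m<2r)
  m≡n+k : m ≡ 2 ℕ.+ r ℕ.+ k
  -- With n = 2 + r the hypothesis `n∸1<m` is by definition n ≤ m, so the truncated difference m - n
  -- is exact.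
  m≡n+k = sym (ℕ.m+[n∸m]≡n n∸1<m)
  m+s≡2r : m ℕ.+ s ≡ 2 ℕ.* r
  m+s≡2r = trans (ℕ.m+[n∸m]≡n (ℕ.<⇒≤ (subst (m ℕ.<_) (sym twice) m<2r))) twice
  r≡ : 2 ℕ.+ k ℕ.+ (s ℕ.+ 0) ≡ r
  r≡ = ℕ.+-cancelˡ-≡ r _ _ (begin
    r ℕ.+ (2 ℕ.+ k ℕ.+ (s ℕ.+ 0))  ≡⟨ solveℕ r k s ⟩
    2 ℕ.+ r ℕ.+ k ℕ.+ s            ≡⟨ cong (ℕ._+ s) (sym m≡n+k) ⟩
    m ℕ.+ s                        ≡⟨ m+s≡2r ⟩
    2 ℕ.* r                        ≡⟨ cong (r ℕ.+_) (ℕ.+-identityʳ r) ⟩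
    r ℕ.+ r ∎)
    where
    solveℕ : ∀ r k s → r ℕ.+ (2 ℕ.+ k ℕ.+ (s ℕ.+ 0)) ≡ 2 ℕ.+ r ℕ.+ k ℕ.+ s
    solveℕ = ℕSolver.solve-∀
  m≡ : 2 ℕ.+ k ℕ.+ (s ℕ.+ 0) ℕ.+ (2 ℕ.+ k) ≡ m
  m≡ = trans (cong (ℕ._+ (2 ℕ.+ k)) r≡) (trans (swap r k) (sym m≡n+k))
    where
    swap : ∀ r k → r ℕ.+ (2 ℕ.+ k) ≡ 2 ℕ.+ r ℕ.+ k
    swap = ℕSolver.solve-∀
theorem5p2 0 m () n∸1<m m<2r
theorem5p2 1 m (s≤s ()) n∸1<m m<2r
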